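{- Let $I$ be an umbral graph polynomial invariant with values in the polynomial ring $\mathbb{C}[q_1,q_2,\dots]$ in infinitely many variables, and let $$\mathcal{I}^\circ(q_1,q_2,\dots)=\sum_{G}\frac{I_G(q_1,q_2,\dots)}{|\mathrm{Aut}(G)|},$$ the sum running over all graphs (isomorphism classes of simple graphs, including the empty graph). After the rescaling of the variables $$q_n=\frac{2^{n(n-1)/2}(n-1)!}{i_n}\,p_n,\qquad n=1,2,\dots,$$ where the constants $i_n$ are given by $$i_n=n!\sum_{G\text{ connected}}\frac{[q_n]I_G(q_1,q_2,\dots)}{|\mathrm{Aut}(G)|}$$ (the sum running over isomorphism classes of non-empty connected simple graphs, $[q_n]I_G$ denoting the coefficient of the monomial $q_n$ in $I_G$), the generating function $\mathcal{I}^\circ$ becomes the following linear combination of one-part Schur polynomials: $$\mathcal{S}(p_1,p_2,\dots)=1+2^0s_1(p_1)+2^1s_2(p_1,p_2)+\dots+2^{n(n-1)/2}s_n(p_1,p_2,\dots,p_n)+\dots.$$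
   Context: Graphs are finite; a simple graph has no loops or multiple edges. $\mathrm{Aut}(G)$ is the automorphism group of $G$ and $|\mathrm{Aut}(G)|$ its order. The empty graph is not counted as connected. Hopf algebra of graphs. $\mathcal{G}=\bigoplus_{n\ge0}\mathcal{G}_n$ is the graded vector space over $\mathbb{C}$ with basis the isomorphism classes of simple graphs, $\mathcal{G}_n$ being spanned by graphs with $n$ vertices. The product is disjoint union (unit: the empty graph) and the coproduct is $\Delta(G)=\sum_{V(G)=V_1\sqcup V_2}G(V_1)\otimes G(V_2)$, the sum over ordered partitions of $V(G)$ into two (possibly empty) subsets, with $G(V_i)$ the induced subgraph; the counit is $1$ on the empty graph and $0$ on all other graphs. This is a commutative cocommutative graded Hopf algebra. The polynomial ring $\mathbb{C}[q_1,q_2,\dots]$ is a graded Hopf algebra with its usual multiplication, $\deg q_n=n$ and $\Delta(q_n)=q_n\otimes1+1\otimes q_n$. An umbral graph polynomial invariant is an arbitrary homomorphism of graded Hopf algebras $I:\mathcal{G}\to\mathbb{C}[q_1,q_2,\dots]$, $G\mapsto I_G$. The one-part Schur polynomials $s_n=s_n(p_1,\dots,p_n)$ are defined by $\sum_{n\ge0}s_n=\exp\left(\sum_{k\ge1}p_k/k\right)$, $s_n$ being the part of weighted degree $n$, where $p_i$ has degree $i$. -}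

module Defs where

open import Algebra.Bundles using (CommutativeRing; Monoid; RawMonoid)
open import Algebra.Apartness.Bundles using (HeytingField; HeytingCommutativeRing)
open import Algebra.Core using (Op₂)
open import Algebra.Definitions.RawMonoid using () renaming (_×_ to times)
open import Algebra.Module.Bundles.Raw using (RawLeftSemimodule)
open import Algebra.Module.Morphism.Structures using (module LeftSemimoduleMorphisms)
open import Algebra.Morphism.Structures using (module MonoidMorphisms)
open import Data.Bool.Base using (Bool; true; false; if_then_else_)
import Data.Bool.Properties as Bool
open import Data.Fin.Base using (Fin; zero; suc; splitAt; punchIn)
import Data.Fin.Properties as Fin
open import Data.Fin.Permutation as Perm
  using (Permutation; Permutation′; _⟨$⟩ʳ_; insert; remove; insert-remove; flip; _∘ₚ_; ↔⇒≡)
open import Data.Fin.Subset using (Subset; inside; outside; ∁)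
open import Data.Fin.Subset.Properties using (_∈?_)
open import Data.List.Base
  using (List; []; _∷_; _++_; [_]; map; concatMap; cartesianProductWith; filter;
         deduplicate; allFin; lookup; length; foldr)
open import Data.List.Properties using (++-assoc; ++-identityʳ; filter-accept; filter-reject)
open import Data.List.Membership.Propositional using (_∈_; find; lose)
open import Data.List.Membership.Propositional.Properties
  using (∈-allFin; ∈-cartesianProductWith⁺; ∈-∃++; ∈-filter⁺)
import Data.List.Membership.DecPropositional as DecMembership
open import Data.List.Relation.Binary.Permutation.Propositional
  using (_↭_; ↭-refl; ↭-sym; ↭-trans; ↭-prep)
open import Data.List.Relation.Binary.Permutation.Propositional.Properties
  using (shift; drop-∷; ∈-resp-↭; ¬x∷xs↭[]; map⁺)
open import Data.List.Relation.Unary.Any using (here; there; any?)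
open import Data.Nat.Base as ℕ
  using (ℕ; zero; suc; pred; NonZero; _^_; _∸_; _/_; _!; _≤_; _<_; s≤s)
open import Data.Nat.ListAction using (sum)
open import Data.Nat.ListAction.Properties using (sum-↭)
import Data.Nat.Properties as ℕ
open import Data.Product.Base using (∃; ∃-syntax; _×_; _,_; proj₁; proj₂; zip)
open import Data.Product.Relation.Binary.Pointwise.NonDependent using (×-decSetoid)
open import Data.Sum.Base using (_⊎_; inj₁; inj₂)
open import Data.Vec.Base as Vec using ()
open import Function.Base using (_∘_; case_of_)
open import Level as Level using (0ℓ; _⊔_)
open import Relation.Binary.Bundles using (DecSetoid)
open import Relation.Binary.Construct.Closure.ReflexiveTransitive using (Star; ε; _◅_; _◅◅_)
open import Relation.Binary.Core using (Rel)
open import Relation.Binary.Definitions using (Decidable)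
open import Relation.Binary.PropositionalEquality as ≡ using (_≡_; _≢_; refl; cong)
open import Relation.Nullary.Decidable.Core
  using (Dec; yes; no; does; map′; _×-dec_; _⊎-dec_)
open import Relation.Nullary.Negation.Core using (contradiction)

record SimpleGraph (n : ℕ) : Set where
  field
    adj        : Fin n → Fin n → Bool
    adj-sym    : ∀ u v → adj u v ≡ adj v u
    adj-irrefl : ∀ v → adj v v ≡ false

  Adj : Rel (Fin n) 0ℓ
  Adj u v = adj u v ≡ true

open SimpleGraph

Graph : Set
Graph = ∃ SimpleGraph

order : Graph → ℕ
order = proj₁

emptyGraph : SimpleGraph 0
emptyGraph = record { adj = λ () ; adj-sym = λ () ; adj-irrefl = λ () }

pullback : ∀ {m n} → (Fin m → Fin n) → SimpleGraph n → SimpleGraph m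
pullback f G = record
  { adj        = λ u v → adj G (f u) (f v)
  ; adj-sym    = λ u v → adj-sym G (f u) (f v)
  ; adj-irrefl = λ v → adj-irrefl G (f v)
  }

elements : ∀ {n} → Subset n → List (Fin n)
elements S = filter (_∈? S) (allFin _)

induced : ∀ {n} → SimpleGraph n → Subset n → Graph
induced G S = length (elements S) , pullback (lookup (elements S)) G

disjointUnion : ∀ {m n} → SimpleGraph m → SimpleGraph n → SimpleGraph (m ℕ.+ n)
disjointUnion {m} {n} G H = record
  { adj        = λ u v → adj⊎ (splitAt m u) (splitAt m v)
  ; adj-sym    = λ u v → sym⊎ (splitAt m u) (splitAt m v)
  ; adj-irrefl = λ v → irrefl⊎ (splitAt m v)
  }
  where
  adj⊎ : Fin m ⊎ Fin n → Fin m ⊎ Fin n → Bool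
  adj⊎ (inj₁ u) (inj₁ v) = adj G u v
  adj⊎ (inj₂ u) (inj₂ v) = adj H u v
  adj⊎ (inj₁ _) (inj₂ _) = false
  adj⊎ (inj₂ _) (inj₁ _) = false

  sym⊎ : ∀ u v → adj⊎ u v ≡ adj⊎ v u
  sym⊎ (inj₁ u) (inj₁ v) = adj-sym G u v
  sym⊎ (inj₂ u) (inj₂ v) = adj-sym H u v
  sym⊎ (inj₁ _) (inj₂ _) = refl
  sym⊎ (inj₂ _) (inj₁ _) = refl

  irrefl⊎ : ∀ v → adj⊎ v v ≡ false
  irrefl⊎ (inj₁ v) = adj-irrefl G v
  irrefl⊎ (inj₂ v) = adj-irrefl H v

infixr 6 _⊔ᴳ_

_⊔ᴳ_ : Graph → Graph → Graph
(m , G) ⊔ᴳ (n , H) = m ℕ.+ n , disjointUnion G H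

IsIso : ∀ {m n} → SimpleGraph m → SimpleGraph n → Permutation m n → Set
IsIso G H π = ∀ u v → adj G u v ≡ adj H (π ⟨$⟩ʳ u) (π ⟨$⟩ʳ v)

infix 4 _≅_ _≅?_ _≅ᴳ_

_≅_ : ∀ {m n} → SimpleGraph m → SimpleGraph n → Set
G ≅ H = ∃[ π ] IsIso G H π

≅-refl : ∀ {n} {G : SimpleGraph n} → G ≅ G
≅-refl = Perm.id , λ _ _ → refl

≅-sym : ∀ {m n} {G : SimpleGraph m} {H : SimpleGraph n} → G ≅ H → H ≅ G
≅-sym {H = H} (π , iso) = flip π , λ u v → ≡.trans
  (≡.cong₂ (adj H) (≡.sym (Perm.inverseʳ π)) (≡.sym (Perm.inverseʳ π)))
  (≡.sym (iso _ _))

≅-trans : ∀ {l m n} {F : SimpleGraph l} {G : SimpleGraph m} {H : SimpleGraph n} →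
          F ≅ G → G ≅ H → F ≅ H
≅-trans (π , iso) (ρ , iso′) = π ∘ₚ ρ , λ u v → ≡.trans (iso u v) (iso′ _ _)

isIso? : ∀ {m n} (G : SimpleGraph m) (H : SimpleGraph n) π → Dec (IsIso G H π)
isIso? G H π = Fin.all? λ u → Fin.all? λ v → adj G u v Bool.≟ adj H (π ⟨$⟩ʳ u) (π ⟨$⟩ʳ v)

-- Every permutation is listed exactly once up to pointwise equality: π is
-- determined by π 0 and by remove 0 π.
permutations : ∀ n → List (Permutation′ n)
permutations zero    = [ Perm.id ]
permutations (suc n) = cartesianProductWith (insert zero) (allFin (suc n)) (permutations n)

insert-cong : ∀ {n} j {π ρ : Permutation′ n} → π Perm.≈ ρ →
              insert zero j π Perm.≈ insert zero j ρ
insert-cong j π≈ρ zero    = refl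
insert-cong j π≈ρ (suc k) = cong (punchIn j) (π≈ρ k)

permutations-complete : ∀ {n} (π : Permutation′ n) → ∃[ ρ ] ρ ∈ permutations n × ρ Perm.≈ π
permutations-complete {zero}  π = Perm.id , here refl , λ ()
permutations-complete {suc n} π with permutations-complete (remove zero π)
... | ρ , ρ∈ , ρ≈ =
  insert zero (π ⟨$⟩ʳ zero) ρ ,
  ∈-cartesianProductWith⁺ (insert zero) (∈-allFin _) ρ∈ ,
  λ k → ≡.trans (insert-cong _ {ρ} {remove zero π} ρ≈ k) (insert-remove zero π k)

IsIso-resp : ∀ {m n} (G : SimpleGraph m) (H : SimpleGraph n) {π ρ : Permutation m n} →
             ρ Perm.≈ π → IsIso G H π → IsIso G H ρ
IsIso-resp G H ρ≈π iso u v =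
  ≡.trans (iso u v) (≡.cong₂ (adj H) (≡.sym (ρ≈π u)) (≡.sym (ρ≈π v)))

_≅?_ : ∀ {m n} (G : SimpleGraph m) (H : SimpleGraph n) → Dec (G ≅ H)
_≅?_ {m} {n} G H with m ℕ.≟ n
... | no  m≢n  = no λ (π , _) → m≢n (↔⇒≡ π)
... | yes refl = map′
  (λ any → let π , _ , iso = find any in π , iso)
  (λ (π , iso) → let ρ , ρ∈ , ρ≈π = permutations-complete π in
                 lose ρ∈ (IsIso-resp G H {π} {ρ} ρ≈π iso))
  (any? (isIso? G H) (permutations m))

_≅ᴳ_ : Rel Graph 0ℓ
(_ , G) ≅ᴳ (_ , H) = G ≅ H

graphs : DecSetoid 0ℓ 0ℓ
graphs = record
  { Carrier          = Graph
  ; _≈_              = _≅ᴳ_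
  ; isDecEquivalence = record
    { isEquivalence = record
      { refl  = λ {G} → ≅-refl {G = proj₂ G}
      ; sym   = λ {G} {H} → ≅-sym {G = proj₂ G} {H = proj₂ H}
      ; trans = λ {F} {G} {H} → ≅-trans {F = proj₂ F} {G = proj₂ G} {H = proj₂ H}
      }
    ; _≟_ = λ (_ , G) (_ , H) → G ≅? H
    }
  }

automorphisms : ∀ {n} → SimpleGraph n → List (Permutation′ n)
automorphisms G = filter (isIso? G G) (permutations _)

∣Aut_∣ : ∀ {n} → SimpleGraph n → ℕ
∣Aut G ∣ = length (automorphisms G)

∣Aut∣-nonZero : ∀ {n} (G : SimpleGraph n) → NonZero ∣Aut G ∣
∣Aut∣-nonZero G with permutations-complete Perm.id
... | ρ , ρ∈ , ρ≈id = nonEmpty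
  (∈-filter⁺ (isIso? G G) ρ∈ (IsIso-resp G G {Perm.id} {ρ} ρ≈id λ _ _ → refl))
  where
  nonEmpty : ∀ {A : Set} {x : A} {xs} → x ∈ xs → NonZero (length xs)
  nonEmpty {xs = _ ∷ _} _ = _

subsets : ∀ n → List (Subset n)
subsets zero    = [ Vec.[] ]
subsets (suc n) = cartesianProductWith Vec._∷_ (outside ∷ inside ∷ []) (subsets n)

-- Adds the vertex zero, with neighbourhood S.
addVertex : ∀ {n} → Subset n → SimpleGraph n → SimpleGraph (suc n)
addVertex {n} S G = record { adj = adj⁺ ; adj-sym = sym⁺ ; adj-irrefl = irrefl⁺ }
  where
  adj⁺ : Fin (suc n) → Fin (suc n) → Bool
  adj⁺ zero    zero    = false
  adj⁺ zero    (suc v) = Vec.lookup S v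
  adj⁺ (suc u) zero    = Vec.lookup S u
  adj⁺ (suc u) (suc v) = adj G u v

  sym⁺ : ∀ u v → adj⁺ u v ≡ adj⁺ v u
  sym⁺ zero    zero    = refl
  sym⁺ zero    (suc v) = refl
  sym⁺ (suc u) zero    = refl
  sym⁺ (suc u) (suc v) = adj-sym G u v

  irrefl⁺ : ∀ v → adj⁺ v v ≡ false
  irrefl⁺ zero    = refl
  irrefl⁺ (suc v) = adj-irrefl G v

-- Every simple graph on the vertex set Fin n, exactly once.
labelledGraphs : ∀ n → List (SimpleGraph n)
labelledGraphs zero    = [ emptyGraph ]
labelledGraphs (suc n) = cartesianProductWith addVertex (subsets n) (labelledGraphs n)

-- One representative of every isomorphism class of graphs with n vertices.
isoClasses : ∀ n → List (SimpleGraph n)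
isoClasses n = deduplicate _≅?_ (labelledGraphs n)

Connected : ∀ {n} → SimpleGraph n → Set
Connected {n} G = 0 < n × (∀ u v → Star (Adj G) u v)

module _ {n} (G : SimpleGraph n) where

  -- Vertices joined by a path with all its inner vertices in a given list.
  PathVia : List (Fin n) → Rel (Fin n) 0ℓ
  PathVia []       u v = u ≡ v ⊎ Adj G u v
  PathVia (w ∷ ws) u v = PathVia ws u v ⊎ (PathVia ws u w × PathVia ws w v)

  pathVia? : ∀ ws → Decidable (PathVia ws)
  pathVia? []       u v = u Fin.≟ v ⊎-dec adj G u v Bool.≟ true
  pathVia? (w ∷ ws) u v = pathVia? ws u v ⊎-dec (pathVia? ws u w ×-dec pathVia? ws w v)

  pathVia-base : ∀ ws {u v} → PathVia [] u v → PathVia ws u v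
  pathVia-base []       p = p
  pathVia-base (w ∷ ws) p = inj₁ (pathVia-base ws p)

  pathVia-trans : ∀ {ws w u v} → w ∈ ws → PathVia ws u w → PathVia ws w v → PathVia ws u v
  pathVia-trans {x ∷ ws} (here refl) p q = inj₂ (left p , right q)
    where
    left : ∀ {u} → PathVia (x ∷ ws) u x → PathVia ws u x
    left (inj₁ p)       = p
    left (inj₂ (p , _)) = p
    right : ∀ {v} → PathVia (x ∷ ws) x v → PathVia ws x v
    right (inj₁ p)       = p
    right (inj₂ (_ , p)) = p
  pathVia-trans {x ∷ ws} (there w∈) (inj₁ p) (inj₁ q) = inj₁ (pathVia-trans w∈ p q)
  pathVia-trans {x ∷ ws} (there w∈) (inj₁ p) (inj₂ (q , r)) = inj₂ (pathVia-trans w∈ p q , r)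
  pathVia-trans {x ∷ ws} (there w∈) (inj₂ (p , q)) (inj₁ r) = inj₂ (p , pathVia-trans w∈ q r)
  pathVia-trans {x ∷ ws} (there w∈) (inj₂ (p , _)) (inj₂ (_ , r)) = inj₂ (p , r)

  pathVia⇒star : ∀ ws {u v} → PathVia ws u v → Star (Adj G) u v
  pathVia⇒star []       (inj₁ refl)    = ε
  pathVia⇒star []       (inj₂ a)       = a ◅ ε
  pathVia⇒star (w ∷ ws) (inj₁ p)       = pathVia⇒star ws p
  pathVia⇒star (w ∷ ws) (inj₂ (p , q)) = pathVia⇒star ws p ◅◅ pathVia⇒star ws q

  star⇒pathVia : ∀ {u v} → Star (Adj G) u v → PathVia (allFin n) u v
  star⇒pathVia ε        = pathVia-base (allFin n) (inj₁ refl)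
  star⇒pathVia (a ◅ as) =
    pathVia-trans (∈-allFin _) (pathVia-base (allFin n) (inj₂ a)) (star⇒pathVia as)

  connected? : Dec (Connected G)
  connected? = 0 ℕ.<? n ×-dec Fin.all? λ u → Fin.all? λ v →
    map′ (pathVia⇒star (allFin n)) star⇒pathVia (pathVia? (allFin n) u v)

connectedClasses : ∀ n → List (SimpleGraph n)
connectedClasses n = filter connected? (isoClasses n)

-- A monomial is a finite multiset of variables; the entry k stands for qₖ₊₁.
Monomial : Set
Monomial = List ℕ

var : (n : ℕ) .{{_ : NonZero n}} → Monomial
var n = [ pred n ]

weight : Monomial → ℕ
weight m = sum (map suc m)

infix 4 _↭?_

_↭?_ : (l m : Monomial) → Dec (l ↭ m)
[]      ↭? []      = yes ↭-refl
[]      ↭? (x ∷ m) = no (¬x∷xs↭[] ∘ ↭-sym)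
(x ∷ l) ↭? m       = case x ∈ℕ? m of λ where
    (no x∉m)  → no λ p → x∉m (∈-resp-↭ p (here refl))
    (yes x∈m) → let as , bs , eq = ∈-∃++ x∈m in remove-x as bs eq
  where
  _∈ℕ?_ = DecMembership._∈?_ ℕ._≟_
  remove-x : ∀ as bs → m ≡ as ++ x ∷ bs → Dec (x ∷ l ↭ m)
  remove-x as bs refl = map′
    (λ p → ↭-trans (↭-prep x p) (↭-sym (shift x as bs)))
    (λ p → drop-∷ (↭-trans p (shift x as bs)))
    (l ↭? (as ++ bs))

monomials : DecSetoid 0ℓ 0ℓ
monomials = record
  { Carrier          = Monomial
  ; _≈_              = _↭_
  ; isDecEquivalence = record
    { isEquivalence = record { refl = ↭-refl ; sym = ↭-sym ; trans = ↭-trans }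
    ; _≟_           = _↭?_
    }
  }

module Sums {c ℓ} (M : Monoid c ℓ) where
  open Monoid M renaming (Carrier to C; ε to 0M; refl to ≈-refl; trans to ≈-trans)

  ∑ : ∀ {a} {A : Set a} → List A → (A → C) → C
  ∑ xs f = foldr (λ x s → f x ∙ s) 0M xs

  ∑< : ℕ → (ℕ → C) → C
  ∑< zero    f = 0M
  ∑< (suc n) f = ∑< n f ∙ f n

  -- Convergence of the series for the discrete topology.
  infix 4 _SumsTo_
  _SumsTo_ : (ℕ → C) → C → Set ℓ
  f SumsTo s = ∃[ N₀ ] ∀ N → N₀ ≤ N → ∑< N f ≈ s

  Convergent : (ℕ → C) → Set (c ⊔ ℓ)
  Convergent f = ∃[ s ] f SumsTo s

  ∑∞ : (f : ℕ → C) → Convergent f → C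
  ∑∞ f (s , _) = s

  ∑-zero : ∀ {a} {A : Set a} (xs : List A) {f : A → C} → (∀ x → f x ≈ 0M) → ∑ xs f ≈ 0M
  ∑-zero []       f≈0 = ≈-refl
  ∑-zero (x ∷ xs) f≈0 = ≈-trans (∙-cong (f≈0 x) (∑-zero xs f≈0)) (identityˡ 0M)

  converges : ∀ {f : ℕ → C} d → (∀ n → n ≢ d → f n ≈ 0M) → Convergent f
  converges {f} d f≈0 = f d , suc d , λ N d<N → stable N d<N
    where
    below : ∀ n → n ≤ d → ∑< n f ≈ 0M
    below zero    _   = ≈-refl
    below (suc n) n<d = ≈-trans
      (∙-cong (below n (ℕ.<⇒≤ n<d)) (f≈0 n (ℕ.<⇒≢ n<d)))
      (identityˡ 0M)

    stable : ∀ N → d < N → ∑< N f ≈ f d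
    stable (suc N) (s≤s d≤N) with d ℕ.≟ N
    ... | yes refl = ≈-trans (∙-cong (below N ℕ.≤-refl) ≈-refl) (identityˡ (f N))
    ... | no  d≢N  = ≈-trans
      (∙-cong (stable N (ℕ.≤∧≢⇒< d≤N d≢N)) (f≈0 N (d≢N ∘ ≡.sym)))
      (identityʳ (f d))

module _ {c ℓ₁ ℓ₂} (K : HeytingField c ℓ₁ ℓ₂) where
  open HeytingField K

  fieldRing : CommutativeRing c ℓ₁
  fieldRing = HeytingCommutativeRing.commutativeRing heytingCommutativeRing

  fromℕ : ℕ → Carrier
  fromℕ n = times (CommutativeRing.+-rawMonoid fieldRing) n 1#

  CharacteristicZero : Set ℓ₂
  CharacteristicZero = ∀ n .{{_ : NonZero n}} → fromℕ n # 0#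

-- The library has no complex numbers, so the ground field is an arbitrary field
-- of characteristic zero, with ℂ as an instance.  The apartness x # 0# is the
-- constructive reading of x ≠ 0; over a classical field it can be taken to be it.
module Invariants {c ℓ₁ ℓ₂} (K : HeytingField c ℓ₁ ℓ₂) (char0 : CharacteristicZero K) where

  open HeytingField K using (_#_; #⇒invertible)
  open CommutativeRing (fieldRing K) hiding (refl; sym; trans)
  private
    module K = CommutativeRing (fieldRing K)
    module ∑K = Sums K.+-monoid

  ⌜_⌝ : ℕ → Carrier
  ⌜ n ⌝ = fromℕ K n

  -- The library provides an inverse of x - 0#.
  recip : ∀ {x} → x # 0# → Carrier
  recip x#0 = proj₁ (#⇒invertible x#0)

  1/ : (n : ℕ) .{{_ : NonZero n}} → Carrier
  1/ n = recip (char0 n)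

  1/∣Aut_∣ : ∀ {n} → SimpleGraph n → Carrier
  1/∣Aut G ∣ = 1/ ∣Aut G ∣ {{∣Aut∣-nonZero G}}

  -- Formal linear combinations of elements of X.
  Free : Set → Set c
  Free X = List (Carrier × X)

  private variable
    A B C : Set

  ⟨_⟩ : A → Free A
  ⟨ x ⟩ = [ (1# , x) ]

  infixr 7 _•_
  _•_ : Carrier → Free A → Free A
  a • f = map (λ (b , x) → a * b , x) f

  extend : (A → Free B) → Free A → Free B
  extend h = concatMap (λ (a , x) → a • h x)

  bilinear : (A → B → C) → Free A → Free B → Free C
  bilinear op = cartesianProductWith (λ (a , x) (b , y) → a * b , op x y)

  -- The tensor product of free vector spaces is free on pairs of basis elements.
  infixr 7 _⊗_
  _⊗_ : Free A → Free B → Free (A × B)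
  _⊗_ = bilinear _,_

  -- The basis is a set up to a decidable equivalence, and two formal linear
  -- combinations are equal when all their coefficients agree.
  module FreeSpace (X : DecSetoid 0ℓ 0ℓ) where
    private module X = DecSetoid X

    coeff : Free X.Carrier → X.Carrier → Carrier
    coeff []            x = 0#
    coeff ((a , y) ∷ f) x = (if does (y X.≟ x) then a else 0#) + coeff f x

    infix 4 _≋_
    _≋_ : Rel (Free X.Carrier) ℓ₁
    f ≋ g = ∀ x → coeff f x ≈ coeff g x

    coeff-++ : ∀ f g x → coeff (f ++ g) x ≈ coeff f x + coeff g x
    coeff-++ []            g x = K.sym (+-identityˡ _)
    coeff-++ ((a , y) ∷ f) g x = K.trans (+-congˡ (coeff-++ f g x)) (K.sym (+-assoc _ _ _))

    coeff-• : ∀ a f x → coeff (a • f) x ≈ a * coeff f x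
    coeff-• a []            x = K.sym (zeroʳ a)
    coeff-• a ((b , y) ∷ f) x = K.trans (+-cong (if-* (does (y X.≟ x))) (coeff-• a f x))
                                        (K.sym (distribˡ a _ _))
      where
      if-* : ∀ t → (if t then a * b else 0#) ≈ a * (if t then b else 0#)
      if-* true  = K.refl
      if-* false = K.sym (zeroʳ a)

    freeMonoid : Monoid c ℓ₁
    freeMonoid = record
      { Carrier = Free X.Carrier
      ; _≈_     = _≋_
      ; _∙_     = _++_
      ; ε       = []
      ; isMonoid = record
        { isSemigroup = record
          { isMagma = record
            { isEquivalence = record
              { refl  = λ x → K.refl
              ; sym   = λ p x → K.sym (p x)
              ; trans = λ p q x → K.trans (p x) (q x)
              }
            ; ∙-cong = λ {f} {f′} {g} {g′} p q x →
                K.trans (coeff-++ f g x)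
                  (K.trans (+-cong (p x) (q x)) (K.sym (coeff-++ f′ g′ x)))
            }
          ; assoc = λ f g h x → K.reflexive (cong (λ k → coeff k x) (++-assoc f g h))
          }
        ; identity = (λ f x → K.refl)
                   , (λ f x → K.reflexive (cong (λ k → coeff k x) (++-identityʳ f)))
        }
      }

    freeModule : RawLeftSemimodule Carrier c ℓ₁
    freeModule = record
      { Carrierᴹ = Free X.Carrier
      ; _≈ᴹ_     = _≋_
      ; _+ᴹ_     = _++_
      ; _*ₗ_     = _•_
      ; 0ᴹ       = []
      }

  -- The structure maps of a graded Hopf algebra having a homogeneous basis that
  -- contains the unit and is closed under products, given on that basis.
  record BasedHopfAlgebra : Set (Level.suc 0ℓ ⊔ c) where
    field
      basis : DecSetoid 0ℓ 0ℓ

    open DecSetoid basis public using () renaming (Carrier to Basis; _≈_ to _≈ᴮ_; _≟_ to _≟ᴮ_)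

    field
      degree      : Basis → ℕ
      degree-cong : ∀ {x y} → x ≈ᴮ y → degree x ≡ degree y
      mult        : Op₂ Basis
      unit        : Basis
      comult      : Basis → Free (Basis × Basis)
      counit      : Basis → Carrier

    open FreeSpace basis public
    module ⊗² = FreeSpace (×-decSetoid basis basis)

    Element : Set c
    Element = Free Basis

    infixl 7 _·_
    _·_ : Op₂ Element
    _·_ = bilinear mult

    𝟙 : Element
    𝟙 = ⟨ unit ⟩

    Δ : Element → Free (Basis × Basis)
    Δ = extend comult

    ϵ : Element → Carrier
    ϵ f = ∑K.∑ f λ (a , x) → a * counit x

    Homogeneous : ℕ → Element → Set ℓ₁
    Homogeneous n f = ∀ x → degree x ≢ n → coeff f x ≈ 0#

    part : ℕ → Element → Element
    part n = filter (λ (a , x) → degree x ℕ.≟ n)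

    part-accept : ∀ {n a y} f → degree y ≡ n → part n ((a , y) ∷ f) ≡ (a , y) ∷ part n f
    part-accept {n} f = filter-accept (λ (a , x) → degree x ℕ.≟ n) {xs = f}

    part-reject : ∀ {n a y} f → degree y ≢ n → part n ((a , y) ∷ f) ≡ part n f
    part-reject {n} f = filter-reject (λ (a , x) → degree x ℕ.≟ n) {xs = f}

    ·-rawMonoid : RawMonoid c ℓ₁
    ·-rawMonoid = record { Carrier = Element ; _≈_ = _≋_ ; _∙_ = _·_ ; ε = 𝟙 }

    ⟨⟩-homogeneous : ∀ x → Homogeneous (degree x) ⟨ x ⟩
    ⟨⟩-homogeneous x y y≢x with x ≟ᴮ y
    ... | yes x≈y = contradiction (≡.sym (degree-cong x≈y)) y≢x
    ... | no  _   = +-identityˡ 0#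

    part-≡ : ∀ n f x → degree x ≡ n → coeff (part n f) x ≈ coeff f x
    part-≡ n []            x dx = K.refl
    part-≡ n ((a , y) ∷ f) x dx = case degree y ℕ.≟ n of λ where
        (yes dy) → K.trans (K.reflexive (cong (λ g → coeff g x) (part-accept f dy)))
                           (+-congˡ (part-≡ n f x dx))
        (no dy)  → K.trans (K.reflexive (cong (λ g → coeff g x) (part-reject f dy)))
                           (K.trans (part-≡ n f x dx) (absent dy))
      where
      absent : degree y ≢ n → coeff f x ≈ coeff ((a , y) ∷ f) x
      absent dy with y ≟ᴮ x
      ... | yes y≈x = contradiction (≡.trans (degree-cong y≈x) dx) dy
      ... | no  _   = K.sym (+-identityˡ _)

    part-≢ : ∀ n f x → degree x ≢ n → coeff (part n f) x ≈ 0#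
    part-≢ n []            x dx = K.refl
    part-≢ n ((a , y) ∷ f) x dx = case degree y ℕ.≟ n of λ where
        (no dy)  → K.trans (K.reflexive (cong (λ g → coeff g x) (part-reject f dy)))
                           (part-≢ n f x dx)
        (yes dy) → K.trans (K.reflexive (cong (λ g → coeff g x) (part-accept f dy)))
                           (present dy)
      where
      present : degree y ≡ n → coeff ((a , y) ∷ part n f) x ≈ 0#
      present dy with y ≟ᴮ x
      ... | yes y≈x = contradiction (≡.trans (≡.sym (degree-cong y≈x)) dy) dx
      ... | no  _   = K.trans (+-identityˡ _) (part-≢ n f x dx)

    part-homogeneous : ∀ {m n} → m ≢ n → ∀ f → Homogeneous m f → part n f ≋ []
    part-homogeneous {m} {n} m≢n f hom x with degree x ℕ.≟ n
    ... | no  dx = part-≢ n f x dx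
    ... | yes dx = K.trans (part-≡ n f x dx) (hom x λ dx′ → m≢n (≡.trans (≡.sym dx′) dx))

  -- Compatibility with the antipodes is not listed, since it holds for every
  -- homomorphism of bialgebras between Hopf algebras.
  record GradedHopfHomomorphism (A B : BasedHopfAlgebra) : Set (c ⊔ ℓ₁) where
    private
      module A = BasedHopfAlgebra A
      module B = BasedHopfAlgebra B
    open LeftSemimoduleMorphisms A.freeModule B.freeModule
      using (IsLeftSemimoduleHomomorphism)
    open MonoidMorphisms A.·-rawMonoid B.·-rawMonoid using (IsMonoidHomomorphism)

    field
      ⟦_⟧      : A.Element → B.Element
      linear   : IsLeftSemimoduleHomomorphism ⟦_⟧
      ·-homo   : IsMonoidHomomorphism ⟦_⟧

    ⟦_⟧⊗⟦_⟧ : Free (A.Basis × A.Basis) → Free (B.Basis × B.Basis)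
    ⟦_⟧⊗⟦_⟧ = extend λ (x , y) → ⟦ ⟨ x ⟩ ⟧ ⊗ ⟦ ⟨ y ⟩ ⟧

    field
      Δ-homo   : ∀ f → B.Δ ⟦ f ⟧ B.⊗².≋ ⟦_⟧⊗⟦_⟧ (A.Δ f)
      ϵ-homo   : ∀ f → B.ϵ ⟦ f ⟧ ≈ A.ϵ f
      graded   : ∀ n f → A.Homogeneous n f → B.Homogeneous n ⟦ f ⟧

  graphAlgebra : BasedHopfAlgebra
  graphAlgebra = record
    { basis       = graphs
    ; degree      = order
    ; degree-cong = λ (π , _) → ↔⇒≡ π
    ; mult        = _⊔ᴳ_
    ; unit        = 0 , emptyGraph
    ; comult      = λ (n , G) → concatMap
                      (λ S → ⟨ induced G S ⟩ ⊗ ⟨ induced G (∁ S) ⟩) (subsets n)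
    ; counit      = λ { (zero , _) → 1# ; (suc _ , _) → 0# }
    }

  -- The homomorphism of algebras with Δ q = q ⊗ 1 + 1 ⊗ q on the variables.
  polynomialComult : Monomial → Free (Monomial × Monomial)
  polynomialComult []      = ⟨ [] ⟩ ⊗ ⟨ [] ⟩
  polynomialComult (k ∷ m) = bilinear (zip _++_ _++_)
    (⟨ [ k ] ⟩ ⊗ ⟨ [] ⟩ ++ ⟨ [] ⟩ ⊗ ⟨ [ k ] ⟩) (polynomialComult m)

  polynomialAlgebra : BasedHopfAlgebra
  polynomialAlgebra = record
    { basis       = monomials
    ; degree      = weight
    ; degree-cong = λ p → sum-↭ (map⁺ suc p)
    ; mult        = _++_
    ; unit        = []
    ; comult      = polynomialComult
    ; counit      = λ { [] → 1# ; (_ ∷ _) → 0# }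
    }

  UmbralInvariant : Set (c ⊔ ℓ₁)
  UmbralInvariant = GradedHopfHomomorphism graphAlgebra polynomialAlgebra

  open BasedHopfAlgebra polynomialAlgebra public
    using (part; coeff; coeff-•; _≋_)
    renaming (Element to Polynomial; _·_ to _·ᴾ_; 𝟙 to 1ᴾ)

  module ∑P = Sums (BasedHopfAlgebra.freeMonoid polynomialAlgebra)

  -- A family f stands for the power series ∑ₙ f n, in which f n is the
  -- homogeneous component of weighted degree n.
  PowerSeries : Set c
  PowerSeries = ℕ → Polynomial

  infix 4 _≋ˢ_
  _≋ˢ_ : Rel PowerSeries ℓ₁
  f ≋ˢ g = ∀ n → f n ≋ g n

  1ˢ : PowerSeries
  1ˢ zero    = 1ᴾ
  1ˢ (suc _) = []

  infixl 7 _·ˢ_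
  _·ˢ_ : Op₂ PowerSeries
  (f ·ˢ g) n = ∑P.∑< (suc n) λ k → f k ·ᴾ g (n ∸ k)

  powˢ : PowerSeries → ℕ → PowerSeries
  powˢ f zero    = 1ˢ
  powˢ f (suc j) = f ·ˢ powˢ f j

  -- For f without constant term: fʲ has no component of degree below j, so
  -- the terms fʲ/j! with j > n do not contribute in degree n.
  expˢ : PowerSeries → PowerSeries
  expˢ f n = ∑P.∑< (suc n) λ j → 1/ (j !) {{ℕ._!≢0 j}} • powˢ f j n

  -- The substitution of cₙ pₙ for qₙ.
  rescale : (∀ n .{{_ : NonZero n}} → Carrier) → Polynomial → Polynomial
  rescale c = extend λ m → [ (factor m , m) ]
    where
    factor : Monomial → Carrier
    factor m = foldr (λ k a → c (suc k) * a) 1# m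

  -- ∑ₖ pₖ/k
  powerSums : PowerSeries
  powerSums zero    = []
  powerSums (suc k) = [ (1/ (suc k) , var (suc k)) ]

  schur : ℕ → Polynomial
  schur = expˢ powerSums

  -- n(n-1)/2
  pairs : ℕ → ℕ
  pairs n = n ℕ.* (n ∸ 1) / 2

  𝒮 : PowerSeries
  𝒮 n = ⌜ 2 ^ pairs n ⌝ • schur n

  module _ (I : UmbralInvariant) where
    open GradedHopfHomomorphism I
    private module P = BasedHopfAlgebra polynomialAlgebra

    invariant : ∀ {n} → SimpleGraph n → Polynomial
    invariant {n} G = ⟦ ⟨ n , G ⟩ ⟧

    invariant-homogeneous : ∀ {n} (G : SimpleGraph n) → P.Homogeneous n (invariant G)
    invariant-homogeneous {n} G =
      graded n _ (BasedHopfAlgebra.⟨⟩-homogeneous graphAlgebra (n , G))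

    -- The contribution of the graphs with N vertices to the component of
    -- weighted degree n of the generating function.
    ℐ°-term : ℕ → ℕ → Polynomial
    ℐ°-term n N = ∑P.∑ (isoClasses N) λ G →
      1/∣Aut G ∣ • part n (invariant G)

    ℐ°-converges : ∀ n → ∑P.Convergent (ℐ°-term n)
    ℐ°-converges n = ∑P.converges n λ N N≢n → ∑P.∑-zero (isoClasses N) λ G m →
      K.trans (coeff-• _ (part n (invariant G)) m)
        (K.trans (*-congˡ (P.part-homogeneous N≢n (invariant G) (invariant-homogeneous G) m))
                 (zeroʳ _))

    ℐ° : PowerSeries
    ℐ° n = ∑P.∑∞ (ℐ°-term n) (ℐ°-converges n)

    i-term : (n : ℕ) .{{_ : NonZero n}} → ℕ → Carrier
    i-term n N = ∑K.∑ (connectedClasses N) λ G →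
      coeff (invariant G) (var n) * 1/∣Aut G ∣

    i-converges : ∀ n .{{_ : NonZero n}} → ∑K.Convergent (i-term n)
    i-converges (suc k) = ∑K.converges (suc k) λ N N≢n → ∑K.∑-zero (connectedClasses N) λ G →
      K.trans (*-congʳ (invariant-homogeneous G (var (suc k))
                         λ eq → N≢n (≡.trans (≡.sym eq) (ℕ.+-identityʳ _))))
              (zeroˡ _)

    i : (n : ℕ) .{{_ : NonZero n}} → Carrier
    i n = ⌜ n ! ⌝ * ∑K.∑∞ (i-term n) (i-converges n)

    scaling : (∀ n .{{_ : NonZero n}} → i n # 0#) → ∀ n .{{_ : NonZero n}} → Carrier
    scaling i#0 n = ⌜ 2 ^ pairs n ℕ.* (n ∸ 1) ! ⌝ * recip (i#0 n)

{-# OPTIONS --safe #-}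
module Submission where

-- Write F n m for the coefficient of the monomial m in the sum of I over all labelled
-- graphs on n vertices, and s n m for its coefficient in the Schur polynomial sₙ.  In
-- monomials the entry k stands for the variable qₖ₊₁ or pₖ₊₁; let k ∷ m contain it with
-- multiplicity 1 + t.  Both families obey a recurrence that removes one variable:
--
--   (1 + t) F (k + 1 + n) (k ∷ m) = C(k + 1 + n, k + 1) 2^((k + 1) n) iₖ₊₁ F n m,
--   (1 + t) s (k + 1 + n) (k ∷ m) = s n m / (k + 1).
--
-- For F, compare the coefficients of qₖ₊₁ ⊗ m in Δ I_G = ∑ I_{G|S} ⊗ I_{G|∁S}, the sum over
-- the subsets S of the vertices (pair-D-invariant).  On the left a variable is removed from a
-- monomial in all possible ways, which is differentiation (coeff-Δ, pair-Dδ).  On the right,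
-- sum over all labelled G: only subsets of size k + 1 contribute, because I is graded, and a
-- graph amounts to its two restrictions and a choice among the (k + 1) n possible edges between
-- S and ∁ S (∑-induced, ∑-size).  The factor for S is the sum of [qₖ₊₁] I over labelled graphs,
-- which is iₖ₊₁ (total≈i): a class G has n!/|Aut G| labelled copies (∣Aut∣*copies), and a
-- disconnected graph contributes nothing, since I is multiplicative and a product of two
-- polynomials without constant term has no linear part (disconnected⇒coeffᴵ≈0).  For s, the
-- recurrence says that ∂/∂pₖ₊₁ multiplies exp (∑ pₖ/k) by 1/(k + 1) (schur-D).
--
-- Since F n m is n! times the coefficient of m in the generating function (total≈n!*ℐ°), the
-- rescaling of the variables turns the first recurrence into the second one up to the powers
-- of two, which match because n(n-1)/2 is quadratic in n (2^pairs-+).  The theorem follows by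
-- induction on the monomial, as the multiplicities are invertible in characteristic zero; the
-- coefficients of k ∷ m in degrees at most k, and of 1 in positive degrees, vanish on both sides.

open import Defs
open import Algebra.Apartness.Bundles using (HeytingField)
open import Algebra.Bundles using (CommutativeRing)
import Algebra.Definitions.RawMonoid
open import Algebra.Module.Morphism.Structures using (module LeftSemimoduleMorphisms)
open import Algebra.Morphism.Structures using (module MonoidMorphisms)
import Algebra.Properties.CommutativeSemigroup
import Algebra.Properties.Semiring.Mult
import Algebra.Solver.Ring.NaturalCoefficients.Default
open import Data.Bool.Base using (true; false; if_then_else_)
import Data.Bool.Properties as Bool
open import Data.Fin.Base using (Fin; zero; suc; punchIn; splitAt; join)
open import Data.Fin.Permutation as Perm
  using (Permutation; _⟨$⟩ʳ_; _⟨$⟩ˡ_; _∘ₚ_; insert; remove; flip)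
import Data.Fin.Properties as Fin
open import Data.Fin.Subset using (Subset; inside; outside; ∁; ∣_∣)
open import Data.Fin.Subset.Properties using (_∈?_; ∣∁p∣≡n∸∣p∣)
open import Data.List.Base
  using (List; []; _∷_; _++_; [_]; map; concatMap; cartesianProductWith; filter; length;
         deduplicate; allFin; tabulate; lookup; foldr)
open import Data.List.Membership.Propositional using (_∈_)
import Data.List.Properties as List
open import Data.List.Relation.Binary.Permutation.Propositional as ↭
  using (_↭_; ↭-refl; ↭-sym; ↭-trans; ↭-prep; ↭-swap)
open import Data.List.Relation.Binary.Permutation.Propositional.Properties
  using (¬x∷xs↭[]; ↭-singleton-inv)
open import Data.List.Relation.Unary.Any using (here; there)
open import Data.Nat.Base as ℕ
  using (ℕ; zero; suc; _∸_; _^_; _/_; _!; _≤_; _<_; s≤s; z≤n; NonZero)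
open import Data.Nat.Combinatorics
  using (_C_; nCk≡n!/k![n-k]!; k![n∸k]!∣n!; nCk+nC[k+1]≡[n+1]C[k+1])
open import Data.Nat.DivMod using (m/n*n≡m; m*n/n≡m)
import Data.Nat.Properties as ℕ
open import Data.Nat.Tactic.RingSolver using (solve-∀)
open import Data.Product.Base using (Σ-syntax; ∃-syntax; _×_; _,_; proj₁; proj₂; zip)
open import Data.Product.Relation.Binary.Pointwise.NonDependent using (×-decSetoid)
open import Data.Sum.Base as Sum using (_⊎_; inj₁; inj₂; [_,_]′)
open import Data.Vec.Base as Vec using ([]; _∷_)
import Data.Vec.Properties as Vec
open import Function.Base using (_∘_; id)
open import Level using (Level; 0ℓ; _⊔_)
open import Relation.Binary.Bundles using (DecSetoid)
open import Relation.Binary.Construct.Closure.ReflexiveTransitive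
  using (Star; ε; _◅_; _◅◅_; reverse)
open import Relation.Binary.Definitions using (Decidable)
open import Relation.Binary.PropositionalEquality as ≡ using (_≡_; _≢_; ≢-sym)
import Relation.Binary.Reasoning.Setoid
open import Relation.Nullary.Decidable using (dec-true; dec-false)
open import Relation.Nullary.Decidable.Core using (Dec; yes; no; does; map′; ¬?; _×-dec_)
open import Relation.Nullary.Negation.Core using (¬_; contradiction)

open SimpleGraph

-- Finite sums in a commutative ring

module FiniteSums {c ℓ} (R : CommutativeRing c ℓ) where

  open CommutativeRing R hiding (zero)
  open Sums +-monoid using (∑; ∑<)
  open Relation.Binary.Reasoning.Setoid setoid
  private
    module +S = Algebra.Properties.CommutativeSemigroup +-commutativeSemigroup
    module × = Algebra.Properties.Semiring.Mult semiring

  private variable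
    a₁ a₂ a₃ : Level
    A : Set a₁
    B : Set a₂
    C : Set a₃
    P Q : Set

  ∑-cong-∈ : ∀ (xs : List A) {f g : A → Carrier} →
             (∀ x → x ∈ xs → f x ≈ g x) → ∑ xs f ≈ ∑ xs g
  ∑-cong-∈ []       f≈g = refl
  ∑-cong-∈ (x ∷ xs) f≈g = +-cong (f≈g x (here ≡.refl)) (∑-cong-∈ xs λ y y∈ → f≈g y (there y∈))

  ∑-cong : ∀ (xs : List A) {f g : A → Carrier} → (∀ x → f x ≈ g x) → ∑ xs f ≈ ∑ xs g
  ∑-cong xs f≈g = ∑-cong-∈ xs λ x _ → f≈g x

  ∑-0 : ∀ (xs : List A) {f : A → Carrier} → (∀ x → f x ≈ 0#) → ∑ xs f ≈ 0#
  ∑-0 = Sums.∑-zero +-monoid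

  ∑-+ : ∀ (xs : List A) (f g : A → Carrier) → ∑ xs (λ x → f x + g x) ≈ ∑ xs f + ∑ xs g
  ∑-+ []       f g = sym (+-identityˡ 0#)
  ∑-+ (x ∷ xs) f g = trans (+-congˡ (∑-+ xs f g)) (+S.interchange _ _ _ _)

  ∑-*ˡ : ∀ (xs : List A) a (f : A → Carrier) → ∑ xs (λ x → a * f x) ≈ a * ∑ xs f
  ∑-*ˡ []       a f = sym (zeroʳ a)
  ∑-*ˡ (x ∷ xs) a f = trans (+-congˡ (∑-*ˡ xs a f)) (sym (distribˡ a _ _))

  ∑-*ʳ : ∀ (xs : List A) (f : A → Carrier) a → ∑ xs (λ x → f x * a) ≈ ∑ xs f * a
  ∑-*ʳ xs f a = trans (∑-cong xs λ x → *-comm (f x) a) (trans (∑-*ˡ xs a f) (*-comm a _))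

  ∑-++ : ∀ (xs ys : List A) (f : A → Carrier) → ∑ (xs ++ ys) f ≈ ∑ xs f + ∑ ys f
  ∑-++ []       ys f = sym (+-identityˡ _)
  ∑-++ (x ∷ xs) ys f = trans (+-congˡ (∑-++ xs ys f)) (sym (+-assoc _ _ _))

  ∑-map : ∀ (h : A → B) xs (f : B → Carrier) → ∑ (map h xs) f ≈ ∑ xs (f ∘ h)
  ∑-map h []       f = refl
  ∑-map h (x ∷ xs) f = +-congˡ (∑-map h xs f)

  ∑-concatMap : ∀ (h : A → List B) xs (f : B → Carrier) →
                ∑ (concatMap h xs) f ≈ ∑ xs λ x → ∑ (h x) f
  ∑-concatMap h []       f = refl
  ∑-concatMap h (x ∷ xs) f = trans (∑-++ (h x) _ f) (+-congˡ (∑-concatMap h xs f))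

  ∑-cartesianProductWith : ∀ (op : A → B → C) xs ys (f : C → Carrier) →
    ∑ (cartesianProductWith op xs ys) f ≈ ∑ xs λ x → ∑ ys λ y → f (op x y)
  ∑-cartesianProductWith op []       ys f = refl
  ∑-cartesianProductWith op (x ∷ xs) ys f =
    trans (∑-++ (map (op x) ys) _ f)
          (+-cong (∑-map (op x) ys f) (∑-cartesianProductWith op xs ys f))

  ∑-swap : ∀ (xs : List A) (ys : List B) (f : A → B → Carrier) →
           ∑ xs (λ x → ∑ ys (f x)) ≈ ∑ ys λ y → ∑ xs λ x → f x y
  ∑-swap []       ys f = sym (∑-0 ys λ _ → refl)
  ∑-swap (x ∷ xs) ys f = trans (+-congˡ (∑-swap xs ys f)) (sym (∑-+ ys (f x) _))

  ∑<-cong : ∀ n {f g : ℕ → Carrier} → (∀ k → k < n → f k ≈ g k) → ∑< n f ≈ ∑< n g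
  ∑<-cong zero    f≈g = refl
  ∑<-cong (suc n) f≈g =
    +-cong (∑<-cong n λ k k<n → f≈g k (ℕ.m≤n⇒m≤1+n k<n)) (f≈g n ℕ.≤-refl)

  ∑<-0 : ∀ n {f : ℕ → Carrier} → (∀ k → k < n → f k ≈ 0#) → ∑< n f ≈ 0#
  ∑<-0 zero    f≈0 = refl
  ∑<-0 (suc n) f≈0 = trans
    (+-cong (∑<-0 n λ k k<n → f≈0 k (ℕ.m≤n⇒m≤1+n k<n)) (f≈0 n ℕ.≤-refl)) (+-identityˡ 0#)

  ∑<-+ : ∀ n (f g : ℕ → Carrier) → ∑< n (λ k → f k + g k) ≈ ∑< n f + ∑< n g
  ∑<-+ zero    f g = sym (+-identityˡ 0#)
  ∑<-+ (suc n) f g = trans (+-congʳ (∑<-+ n f g)) (+S.interchange _ _ _ _)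

  ∑<-*ˡ : ∀ n a (f : ℕ → Carrier) → ∑< n (λ k → a * f k) ≈ a * ∑< n f
  ∑<-*ˡ zero    a f = sym (zeroʳ a)
  ∑<-*ˡ (suc n) a f = trans (+-congʳ (∑<-*ˡ n a f)) (sym (distribˡ a _ _))

  ∑<-head : ∀ n (f : ℕ → Carrier) → ∑< (suc n) f ≈ f 0 + ∑< n (f ∘ suc)
  ∑<-head zero    f = +-comm 0# (f 0)
  ∑<-head (suc n) f = trans (+-congʳ (∑<-head n f)) (+-assoc _ _ _)

  -- A sequence that vanishes from n on can be summed up to n.
  ∑<-truncate : ∀ k n {f : ℕ → Carrier} → (∀ j → n ≤ j → f j ≈ 0#) → ∑< (k ℕ.+ n) f ≈ ∑< n f
  ∑<-truncate zero    n f≈0 = refl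
  ∑<-truncate (suc k) n f≈0 = trans
    (+-cong (∑<-truncate k n f≈0) (f≈0 _ (ℕ.m≤n+m n k))) (+-identityʳ _)

  -- The truth value of a decided proposition.
  𝕀 : Dec P → Carrier
  𝕀 d = if does d then 1# else 0#

  𝕀-yes : (d : Dec P) → P → 𝕀 d ≈ 1#
  𝕀-yes (yes _) p = refl
  𝕀-yes (no ¬p) p = contradiction p ¬p

  𝕀-no : (d : Dec P) → ¬ P → 𝕀 d ≈ 0#
  𝕀-no (yes p) ¬p = contradiction p ¬p
  𝕀-no (no _)  ¬p = refl

  𝕀-cong : (d : Dec P) (e : Dec Q) → (P → Q) → (Q → P) → 𝕀 d ≈ 𝕀 e
  𝕀-cong d (yes q) f g = 𝕀-yes d (g q)
  𝕀-cong d (no ¬q) f g = 𝕀-no d (¬q ∘ f)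

  𝕀-× : (d : Dec P) (e : Dec Q) → 𝕀 (d ×-dec e) ≈ 𝕀 d * 𝕀 e
  𝕀-× (yes _) e = sym (*-identityˡ _)
  𝕀-× (no _)  e = sym (zeroˡ _)

  𝕀-*-cong : (d : Dec P) {x y : Carrier} → (P → x ≈ y) → 𝕀 d * x ≈ 𝕀 d * y
  𝕀-*-cong (yes p) x≈y = *-congˡ (x≈y p)
  𝕀-*-cong (no _)  x≈y = trans (zeroˡ _) (sym (zeroˡ _))

  if-𝕀 : (d : Dec P) (x : Carrier) → (if does d then x else 0#) ≈ x * 𝕀 d
  if-𝕀 (yes _) x = sym (*-identityʳ x)
  if-𝕀 (no _)  x = sym (zeroʳ x)

  ∑-filter : {P : A → Set} (P? : ∀ x → Dec (P x)) (xs : List A) (f : A → Carrier) →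
             ∑ (filter P? xs) f ≈ ∑ xs λ x → 𝕀 (P? x) * f x
  ∑-filter P? []       f = refl
  ∑-filter P? (x ∷ xs) f with P? x
  ... | yes _ = +-cong (sym (*-identityˡ _)) (∑-filter P? xs f)
  ... | no  _ = trans (∑-filter P? xs f) (sym (trans (+-congʳ (zeroˡ _)) (+-identityˡ _)))

  ∑<-𝕀 : ∀ n k {f : ℕ → Carrier} → k < n → ∑< n (λ j → 𝕀 (j ℕ.≟ k) * f j) ≈ f k
  ∑<-𝕀 (suc n) k {f} (s≤s k≤n) with n ℕ.≟ k
  ... | yes ≡.refl = trans
    (+-cong (∑<-0 n λ j j<n → trans (*-congʳ (𝕀-no (j ℕ.≟ n) (ℕ.<⇒≢ j<n))) (zeroˡ _))
            (trans (*-congʳ (𝕀-yes (n ℕ.≟ n) ≡.refl)) (*-identityˡ _)))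
    (+-identityˡ _)
  ... | no n≢k = trans
    (+-cong (∑<-𝕀 n k (ℕ.≤∧≢⇒< k≤n (n≢k ∘ ≡.sym))) (trans (*-congʳ (𝕀-no (n ℕ.≟ k) n≢k)) (zeroˡ _)))
    (+-identityʳ _)

  -- The image of a natural number in the ring; in a field it unfolds to ⌜ n ⌝.
  fromNat : ℕ → Carrier
  fromNat n = Algebra.Definitions.RawMonoid._×_ +-rawMonoid n 1#

  fromNat-+ : ∀ m n → fromNat (m ℕ.+ n) ≈ fromNat m + fromNat n
  fromNat-+ m n = ×.×-homo-+ 1# m n

  fromNat-* : ∀ m n → fromNat (m ℕ.* n) ≈ fromNat m * fromNat n
  fromNat-* = ×.×1-homo-*

  fromNat-1 : fromNat 1 ≈ 1#
  fromNat-1 = +-identityʳ 1#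

  ∑-const : ∀ (xs : List A) a → ∑ xs (λ _ → a) ≈ fromNat (length xs) * a
  ∑-const []       a = sym (zeroˡ a)
  ∑-const (x ∷ xs) a = trans (+-cong (sym (*-identityˡ a)) (∑-const xs a)) (sym (distribʳ a _ _))

  ∑-𝕀 : {P : A → Set} (P? : ∀ x → Dec (P x)) (xs : List A) →
        ∑ xs (𝕀 ∘ P?) ≈ fromNat (length (filter P? xs))
  ∑-𝕀 P? xs = begin
    ∑ xs (𝕀 ∘ P?)                       ≈⟨ ∑-cong xs (λ x → sym (*-identityʳ _)) ⟩
    ∑ xs (λ x → 𝕀 (P? x) * 1#)          ≈⟨ sym (∑-filter P? xs _) ⟩
    ∑ (filter P? xs) (λ _ → 1#)         ≈⟨ ∑-const (filter P? xs) 1# ⟩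
    fromNat (length (filter P? xs)) * 1# ≈⟨ *-identityʳ _ ⟩
    fromNat (length (filter P? xs))     ∎

  -- A list enumerates a set up to a decidable relation when each element of the
  -- set is related to exactly one entry, which is counted in the ring.
  Enumerates : {A : Set a₁} {_~_ : A → A → Set} → Decidable _~_ → List A → Set (a₁ ⊔ ℓ)
  Enumerates _~?_ xs = ∀ x → ∑ xs (λ y → 𝕀 (x ~? y)) ≈ 1#

  -- Sums over an enumeration can be reindexed along a map g with inverse h, both up
  -- to the relation: x ~ g y if and only if h x ~ y.
  ∑-reindex : {_~_ : A → A → Set} (_~?_ : Decidable _~_) (xs : List A) →
    Enumerates _~?_ xs → (∀ {x y} → x ~ y → y ~ x) →
    (g h : A → A) → (∀ {x y} → x ~ g y → h x ~ y) → (∀ {x y} → h x ~ y → x ~ g y) →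
    (f : A → Carrier) → (∀ {x y} → x ~ y → f x ≈ f y) →
    ∑ xs (f ∘ g) ≈ ∑ xs f
  ∑-reindex _~?_ xs enum ~-sym g h to from f f-cong = begin
    ∑ xs (f ∘ g)
      ≈⟨ ∑-cong xs (λ y → sym (trans (*-congʳ (enum (g y))) (*-identityˡ _))) ⟩
    ∑ xs (λ y → ∑ xs (λ x → 𝕀 (g y ~? x)) * f (g y))
      ≈⟨ ∑-cong xs (λ y → sym (∑-*ʳ xs _ _)) ⟩
    ∑ xs (λ y → ∑ xs λ x → 𝕀 (g y ~? x) * f (g y))
      ≈⟨ ∑-swap xs xs _ ⟩
    ∑ xs (λ x → ∑ xs λ y → 𝕀 (g y ~? x) * f (g y))
      ≈⟨ ∑-cong xs (λ x → ∑-cong xs λ y → trans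
           (𝕀-*-cong (g y ~? x) f-cong)
           (*-congʳ (𝕀-cong (g y ~? x) (h x ~? y) (to ∘ ~-sym) (~-sym ∘ from)))) ⟩
    ∑ xs (λ x → ∑ xs λ y → 𝕀 (h x ~? y) * f x)
      ≈⟨ ∑-cong xs (λ x → ∑-*ʳ xs _ _) ⟩
    ∑ xs (λ x → ∑ xs (λ y → 𝕀 (h x ~? y)) * f x)
      ≈⟨ ∑-cong xs (λ x → trans (*-congʳ (enum (h x))) (*-identityˡ _)) ⟩
    ∑ xs f ∎

  -- Enumerations of the factors give an enumeration of a product.
  cartesianProductWith-enumerates :
    {_~₁_ : A → A → Set} {_~₂_ : B → B → Set} {_~_ : C → C → Set}
    (_~₁?_ : Decidable _~₁_) (_~₂?_ : Decidable _~₂_) (_~?_ : Decidable _~_) →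
    (op : A → B → C) (p : C → A) (q : C → B) →
    (∀ {z x y} → z ~ op x y → p z ~₁ x × q z ~₂ y) →
    (∀ {z x y} → p z ~₁ x → q z ~₂ y → z ~ op x y) →
    ∀ xs ys → Enumerates _~₁?_ xs → Enumerates _~₂?_ ys →
    Enumerates _~?_ (cartesianProductWith op xs ys)
  cartesianProductWith-enumerates _~₁?_ _~₂?_ _~?_ op p q to from xs ys xs-enum ys-enum z = begin
    ∑ (cartesianProductWith op xs ys) (λ w → 𝕀 (z ~? w))
      ≈⟨ ∑-cartesianProductWith op xs ys _ ⟩
    ∑ xs (λ x → ∑ ys λ y → 𝕀 (z ~? op x y))
      ≈⟨ ∑-cong xs (λ x → ∑-cong ys λ y → trans
           (𝕀-cong (z ~? op x y) (p z ~₁? x ×-dec q z ~₂? y) to (λ (r , s) → from r s))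
           (𝕀-× (p z ~₁? x) (q z ~₂? y))) ⟩
    ∑ xs (λ x → ∑ ys λ y → 𝕀 (p z ~₁? x) * 𝕀 (q z ~₂? y))
      ≈⟨ ∑-cong xs (λ x → trans (∑-*ˡ ys _ _) (trans (*-congˡ (ys-enum (q z))) (*-identityʳ _))) ⟩
    ∑ xs (λ x → 𝕀 (p z ~₁? x))
      ≈⟨ xs-enum (p z) ⟩
    1# ∎

-- Labelled graphs and isomorphism classes

infix 4 _≗ᴳ_ _≗ᴳ?_ _≈ₚ?_

-- Equality of graphs on the same vertex set.
_≗ᴳ_ : ∀ {n} → SimpleGraph n → SimpleGraph n → Set
G ≗ᴳ H = ∀ u v → adj G u v ≡ adj H u v

_≗ᴳ?_ : ∀ {n} → Decidable (_≗ᴳ_ {n})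
G ≗ᴳ? H = Fin.all? λ u → Fin.all? λ v → adj G u v Bool.≟ adj H u v

≗ᴳ⇒≅ : ∀ {n} {G H : SimpleGraph n} → G ≗ᴳ H → G ≅ H
≗ᴳ⇒≅ e = Perm.id , e

_≈ₚ?_ : ∀ {n} → Decidable (Perm._≈_ {n} {n})
π ≈ₚ? ρ = Fin.all? λ k → (π ⟨$⟩ʳ k) Fin.≟ (ρ ⟨$⟩ʳ k)

tabulate-suc : ∀ n → tabulate {n = n} Fin.suc ≡ map Fin.suc (allFin n)
tabulate-suc n = ≡.sym (List.map-tabulate (λ k → k) Fin.suc)

length-cartesianProductWith : ∀ {A B C : Set} (op : A → B → C) xs ys →
  length (cartesianProductWith op xs ys) ≡ length xs ℕ.* length ys
length-cartesianProductWith op []       ys = ≡.refl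
length-cartesianProductWith op (x ∷ xs) ys = ≡.trans (List.length-++ (map (op x) ys))
  (≡.cong₂ ℕ._+_ (List.length-map (op x) ys) (length-cartesianProductWith op xs ys))

length-permutations : ∀ n → length (permutations n) ≡ n !
length-permutations zero    = ≡.refl
length-permutations (suc n) = ≡.trans
  (length-cartesianProductWith (insert zero) (allFin (suc n)) (permutations n))
  (≡.cong₂ ℕ._*_ (List.length-tabulate {n = suc n} (λ k → k)) (length-permutations n))

module GraphSums {c ℓ} (R : CommutativeRing c ℓ) where

  open CommutativeRing R hiding (zero)
  open Sums +-monoid using (∑)
  open FiniteSums R
  open Relation.Binary.Reasoning.Setoid setoid

  bools-enumerate : Enumerates Bool._≟_ (outside ∷ inside ∷ [])
  bools-enumerate true  = trans (+-identityˡ _) (+-identityʳ _)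
  bools-enumerate false = trans (+-congˡ (+-identityʳ _)) (+-identityʳ _)

  subsets-enumerate : ∀ n → Enumerates (Vec.≡-dec Bool._≟_) (subsets n)
  subsets-enumerate zero    [] = +-identityʳ _
  subsets-enumerate (suc n) = cartesianProductWith-enumerates
    Bool._≟_ (Vec.≡-dec Bool._≟_) (Vec.≡-dec Bool._≟_) _∷_ Vec.head Vec.tail
    (λ { ≡.refl → ≡.refl , ≡.refl }) (λ { {_ ∷ _} ≡.refl ≡.refl → ≡.refl })
    (outside ∷ inside ∷ []) (subsets n) bools-enumerate (subsets-enumerate n)

  labelledGraphs-enumerate : ∀ n → Enumerates _≗ᴳ?_ (labelledGraphs n)
  labelledGraphs-enumerate zero    G = trans (+-identityʳ _) (𝕀-yes (G ≗ᴳ? emptyGraph) λ ())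
  labelledGraphs-enumerate (suc n) = cartesianProductWith-enumerates
    (Vec.≡-dec Bool._≟_) _≗ᴳ?_ _≗ᴳ?_ addVertex row (pullback suc)
    (λ {G} {S} e → row≡ {G} S e , λ u v → e (suc u) (suc v))
    (λ {G} {S} {H} e e′ → rebuild {G} S H e e′)
    (subsets n) (labelledGraphs n) (subsets-enumerate n) (labelledGraphs-enumerate n)
    where
    -- The neighbourhood of the vertex zero.
    row : SimpleGraph (suc n) → Subset n
    row G = Vec.tabulate λ v → adj G zero (suc v)

    row≡ : ∀ {G H} S → G ≗ᴳ addVertex S H → row G ≡ S
    row≡ S e = ≡.trans (Vec.tabulate-cong λ v → e zero (suc v)) (Vec.tabulate∘lookup S)

    rebuild : ∀ {G} S H → row G ≡ S → pullback suc G ≗ᴳ H → G ≗ᴳ addVertex S H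
    rebuild {G} S H ≡.refl e′ zero    zero    = adj-irrefl G zero
    rebuild {G} S H ≡.refl e′ zero    (suc v) = ≡.sym (Vec.lookup∘tabulate _ v)
    rebuild {G} S H ≡.refl e′ (suc u) zero    =
      ≡.trans (adj-sym G (suc u) zero) (≡.sym (Vec.lookup∘tabulate _ u))
    rebuild {G} S H ≡.refl e′ (suc u) (suc v) = e′ u v

  permutations-enumerate : ∀ n → Enumerates _≈ₚ?_ (permutations n)
  permutations-enumerate zero    π = trans (+-identityʳ _) (𝕀-yes (π ≈ₚ? Perm.id) λ ())
  permutations-enumerate (suc n) = cartesianProductWith-enumerates
    Fin._≟_ _≈ₚ?_ _≈ₚ?_ (insert zero) (_⟨$⟩ʳ zero) (remove zero)
    (λ {π} {j} {ρ} e → e zero , λ k → Fin.punchIn-injective j _ _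
      (≡.trans (≡.cong (λ i → punchIn i (remove zero π ⟨$⟩ʳ k)) (≡.sym (e zero)))
        (≡.trans (≡.sym (Perm.punchIn-permute π zero k)) (e (suc k)))))
    (λ { {π} {j} {ρ} ≡.refl e k → ≡.trans (≡.sym (Perm.insert-remove zero π k))
      (insert-cong (π ⟨$⟩ʳ zero) {remove zero π} {ρ} e k) })
    (allFin (suc n)) (permutations n) allFin-enumerates (permutations-enumerate n)
    where
    ∑-suc : ∀ {n} (f : Fin (suc n) → Carrier) →
            ∑ (tabulate {n = n} Fin.suc) f ≈ ∑ (allFin n) (f ∘ suc)
    ∑-suc {n} f = trans (reflexive (≡.cong (λ ks → ∑ ks f) (tabulate-suc n)))
                        (∑-map Fin.suc (allFin n) f)

    allFin-enumerates : ∀ {n} → Enumerates Fin._≟_ (allFin n)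
    allFin-enumerates {suc n} zero = trans
      (+-congˡ (trans (∑-suc {n} λ l → 𝕀 (zero Fin.≟ l)) (∑-0 (allFin n) λ _ → refl)))
      (+-identityʳ _)
    allFin-enumerates {suc n} (suc k) = trans (+-identityˡ _)
      (trans (∑-suc {n} λ l → 𝕀 (suc k Fin.≟ l))
        (trans (∑-cong (allFin n) λ l →
                 𝕀-cong (suc k Fin.≟ suc l) (k Fin.≟ l) Fin.suc-injective (≡.cong suc))
               (allFin-enumerates k)))

  module _ {n} (r : SimpleGraph n) where

    -- If there is an isomorphism r → G, composition with it is a bijection from Aut r
    -- to the isomorphisms r → G.
    ∑-isIso : ∀ (G : SimpleGraph n) →
      ∑ (permutations n) (λ π → 𝕀 (isIso? r G π)) ≈ fromNat ∣Aut r ∣ * 𝕀 (r ≅? G)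
    ∑-isIso G = lemma (r ≅? G)
      where
      lemma : (d : Dec (r ≅ G)) →
        ∑ (permutations n) (λ π → 𝕀 (isIso? r G π)) ≈ fromNat ∣Aut r ∣ * 𝕀 d
      lemma (no ¬iso) = trans (∑-0 (permutations n) λ π → 𝕀-no (isIso? r G π) λ iso → ¬iso (π , iso))
                              (sym (zeroʳ _))
      lemma (yes (σ , iso)) = begin
        ∑ (permutations n) (λ π → 𝕀 (isIso? r G π))
          ≈⟨ sym (∑-reindex _≈ₚ?_ (permutations n) (permutations-enumerate n)
               (λ e k → ≡.sym (e k)) (_∘ₚ σ) (_∘ₚ flip σ)
               (λ e k → ≡.trans (≡.cong (σ ⟨$⟩ˡ_) (e k)) (Perm.inverseˡ σ))
               (λ e k → ≡.trans (≡.sym (Perm.inverseʳ σ)) (≡.cong (σ ⟨$⟩ʳ_) (e k)))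
               (λ π → 𝕀 (isIso? r G π))
               (λ {π} {ρ} e → 𝕀-cong (isIso? r G π) (isIso? r G ρ)
                 (IsIso-resp r G {π} {ρ} (λ k → ≡.sym (e k))) (IsIso-resp r G {ρ} {π} e))) ⟩
        ∑ (permutations n) (λ π → 𝕀 (isIso? r G (π ∘ₚ σ)))
          ≈⟨ ∑-cong (permutations n) (λ π → 𝕀-cong (isIso? r G (π ∘ₚ σ)) (isIso? r r π)
               (λ f u v → ≡.trans (f u v) (≡.sym (iso _ _)))
               (λ f u v → ≡.trans (f u v) (iso _ _))) ⟩
        ∑ (permutations n) (λ π → 𝕀 (isIso? r r π))
          ≈⟨ ∑-𝕀 (isIso? r r) (permutations n) ⟩
        fromNat ∣Aut r ∣
          ≈⟨ sym (*-identityʳ _) ⟩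
        fromNat ∣Aut r ∣ * 1# ∎

    -- The orbit-stabiliser formula: both sides count the pairs of a labelled graph G and
    -- an isomorphism r → G, as a permutation of the vertices of r determines G.
    ∣Aut∣*copies : fromNat ∣Aut r ∣ * ∑ (labelledGraphs n) (λ G → 𝕀 (r ≅? G)) ≈ fromNat (n !)
    ∣Aut∣*copies = begin
      fromNat ∣Aut r ∣ * ∑ (labelledGraphs n) (λ G → 𝕀 (r ≅? G))
        ≈⟨ sym (∑-*ˡ (labelledGraphs n) _ _) ⟩
      ∑ (labelledGraphs n) (λ G → fromNat ∣Aut r ∣ * 𝕀 (r ≅? G))
        ≈⟨ ∑-cong (labelledGraphs n) (λ G → sym (∑-isIso G)) ⟩
      ∑ (labelledGraphs n) (λ G → ∑ (permutations n) λ π → 𝕀 (isIso? r G π))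
        ≈⟨ ∑-swap (labelledGraphs n) (permutations n) _ ⟩
      ∑ (permutations n) (λ π → ∑ (labelledGraphs n) λ G → 𝕀 (isIso? r G π))
        ≈⟨ ∑-cong (permutations n) (λ π → trans
             (∑-cong (labelledGraphs n) λ G → 𝕀-cong (isIso? r G π) (pullback (π ⟨$⟩ˡ_) r ≗ᴳ? G)
               (λ f u v → ≡.trans (f _ _) (≡.cong₂ (adj G) (Perm.inverseʳ π) (Perm.inverseʳ π)))
               (λ f u v → ≡.trans
                 (≡.cong₂ (adj r) (≡.sym (Perm.inverseˡ π)) (≡.sym (Perm.inverseˡ π))) (f _ _)))
             (labelledGraphs-enumerate n (pullback (π ⟨$⟩ˡ_) r))) ⟩
      ∑ (permutations n) (λ _ → 1#)
        ≈⟨ trans (∑-const (permutations n) 1#) (*-identityʳ _) ⟩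
      fromNat (length (permutations n))
        ≡⟨ ≡.cong fromNat (length-permutations n) ⟩
      fromNat (n !) ∎

  -- Each listed element is related to exactly one of the retained ones.
  ∑-deduplicate : {A : Set} {_~_ : A → A → Set} (_~?_ : Decidable _~_) →
    (∀ {x y} → x ~ y → y ~ x) → (∀ {x y z} → x ~ y → y ~ z → x ~ z) → (∀ {x} → x ~ x) →
    ∀ {x} xs → x ∈ xs → ∑ (deduplicate _~?_ xs) (λ r → 𝕀 (r ~? x)) ≈ 1#
  ∑-deduplicate {A} {_~_} _~?_ ~-sym ~-trans ~-refl {x} (y ∷ xs) x∈ = lemma (y ~? x)
    where
    rest : List A
    rest = filter (λ r → ¬? (y ~? r)) (deduplicate _~?_ xs)

    lemma : (d : Dec (y ~ x)) → 𝕀 d + ∑ rest (λ r → 𝕀 (r ~? x)) ≈ 1#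
    lemma (yes y~x) = trans
      (+-congˡ (trans (∑-filter _ (deduplicate _~?_ xs) _)
        (∑-0 (deduplicate _~?_ xs) λ r → vanish r (y ~? r))))
      (+-identityʳ 1#)
      where
      vanish : ∀ r (d : Dec (y ~ r)) → 𝕀 (¬? d) * 𝕀 (r ~? x) ≈ 0#
      vanish r (yes _)  = zeroˡ _
      vanish r (no y≁r) = trans (*-identityˡ _)
        (𝕀-no (r ~? x) λ r~x → y≁r (~-trans y~x (~-sym r~x)))
    lemma (no y≁x) = trans (+-identityˡ _) (trans (∑-filter _ (deduplicate _~?_ xs) _)
      (trans (∑-cong (deduplicate _~?_ xs) λ r → keep r (y ~? r))
        (∑-deduplicate _~?_ ~-sym ~-trans ~-refl xs (later x∈))))
      where
      keep : ∀ r (d : Dec (y ~ r)) → 𝕀 (¬? d) * 𝕀 (r ~? x) ≈ 𝕀 (r ~? x)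
      keep r (yes y~r) = trans (zeroˡ _) (sym (𝕀-no (r ~? x) λ r~x → y≁x (~-trans y~r r~x)))
      keep r (no _)    = *-identityˡ _
      later : x ∈ y ∷ xs → x ∈ xs
      later (here ≡.refl) = contradiction ~-refl y≁x
      later (there x∈xs)  = x∈xs

  -- Summing a class function over labelled graphs counts each isomorphism class
  -- with the number of its labelled copies.
  ∑-labelledGraphs : ∀ n (f : SimpleGraph n → Carrier) → (∀ {G H} → G ≅ H → f G ≈ f H) →
    ∑ (labelledGraphs n) f ≈
    ∑ (isoClasses n) λ r → ∑ (labelledGraphs n) (λ G → 𝕀 (r ≅? G)) * f r
  ∑-labelledGraphs n f f-cong = begin
    ∑ (labelledGraphs n) f
      ≈⟨ ∑-cong-∈ (labelledGraphs n) (λ G G∈ → sym (trans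
           (*-congʳ (∑-deduplicate _≅?_ (λ {G} {H} → ≅-sym {G = G} {H})
                       (λ {F} {G} {H} → ≅-trans {F = F} {G} {H})
                       (λ {G} → ≅-refl {G = G}) (labelledGraphs n) G∈))
           (*-identityˡ _))) ⟩
    ∑ (labelledGraphs n) (λ G → ∑ (isoClasses n) (λ r → 𝕀 (r ≅? G)) * f G)
      ≈⟨ ∑-cong (labelledGraphs n) (λ G → sym (∑-*ʳ (isoClasses n) _ _)) ⟩
    ∑ (labelledGraphs n) (λ G → ∑ (isoClasses n) λ r → 𝕀 (r ≅? G) * f G)
      ≈⟨ ∑-swap (labelledGraphs n) (isoClasses n) _ ⟩
    ∑ (isoClasses n) (λ r → ∑ (labelledGraphs n) λ G → 𝕀 (r ≅? G) * f G)
      ≈⟨ ∑-cong (isoClasses n) (λ r → trans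
           (∑-cong (labelledGraphs n) λ G → 𝕀-*-cong (r ≅? G) λ r≅G → sym (f-cong r≅G))
           (∑-*ʳ (labelledGraphs n) _ _)) ⟩
    ∑ (isoClasses n) (λ r → ∑ (labelledGraphs n) (λ G → 𝕀 (r ≅? G)) * f r) ∎

-- Restriction of graphs to a subset of the vertices

-- The increasing enumeration of a subset.
embed : ∀ {n} (S : Subset n) → Fin ∣ S ∣ → Fin n
embed (inside  ∷ S) zero    = zero
embed (inside  ∷ S) (suc k) = suc (embed S k)
embed (outside ∷ S) k       = suc (embed S k)

-- The intersection T ∩ S as a subset of S.
restrict : ∀ {n} (S : Subset n) → Subset n → Subset ∣ S ∣
restrict []            []      = []
restrict (inside  ∷ S) (t ∷ T) = t ∷ restrict S T
restrict (outside ∷ S) (t ∷ T) = restrict S T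

restrict-lookup : ∀ {n} (S T : Subset n) k →
                  Vec.lookup (restrict S T) k ≡ Vec.lookup T (embed S k)
restrict-lookup (inside  ∷ S) (t ∷ T) zero    = ≡.refl
restrict-lookup (inside  ∷ S) (t ∷ T) (suc k) = restrict-lookup S T k
restrict-lookup (outside ∷ S) (t ∷ T) k       = restrict-lookup S T k

infixl 8 _↾_

-- The subgraph induced on S, with S renumbered by embed.
_↾_ : ∀ {n} → SimpleGraph n → (S : Subset n) → SimpleGraph ∣ S ∣
G ↾ S = pullback (embed S) G

addVertex-↾ : ∀ {n} (S T : Subset n) (G : SimpleGraph n) →
  addVertex T G ↾ (inside ∷ S) ≗ᴳ addVertex (restrict S T) (G ↾ S)
addVertex-↾ S T G zero    zero    = ≡.refl
addVertex-↾ S T G zero    (suc v) = ≡.sym (restrict-lookup S T v)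
addVertex-↾ S T G (suc u) zero    = ≡.sym (restrict-lookup S T u)
addVertex-↾ S T G (suc u) (suc v) = ≡.refl

addVertex-cong : ∀ {n} {T : Subset n} {G H} → G ≗ᴳ H → addVertex T G ≗ᴳ addVertex T H
addVertex-cong e zero    zero    = ≡.refl
addVertex-cong e zero    (suc v) = ≡.refl
addVertex-cong e (suc u) zero    = ≡.refl
addVertex-cong e (suc u) (suc v) = e u v

elements≡tabulate : ∀ {n} (S : Subset n) → elements S ≡ tabulate (embed S)
elements≡tabulate []      = ≡.refl
elements≡tabulate {suc n} (s ∷ S) = step s ≡.refl
  where
  filter-suc : ∀ ks → filter (_∈? (s ∷ S)) (map Fin.suc ks) ≡ map Fin.suc (filter (_∈? S) ks)
  filter-suc []       = ≡.refl
  filter-suc (k ∷ ks) with k ∈? S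
  ... | yes _ = ≡.cong (Fin.suc k ∷_) (filter-suc ks)
  ... | no  _ = filter-suc ks

  tail : filter (_∈? (s ∷ S)) (tabulate Fin.suc) ≡ tabulate (Fin.suc ∘ embed S)
  tail = ≡.trans (≡.cong (filter (_∈? (s ∷ S))) (tabulate-suc n))
    (≡.trans (filter-suc (allFin n))
      (≡.trans (≡.cong (map Fin.suc) (elements≡tabulate S)) (List.map-tabulate (embed S) Fin.suc)))

  step : ∀ s′ → s ≡ s′ → elements (s ∷ S) ≡ tabulate (embed (s ∷ S))
  step inside  ≡.refl = ≡.cong (zero ∷_) tail
  step outside ≡.refl = tail

induced≅↾ : ∀ {n} (G : SimpleGraph n) S → induced G S ≅ᴳ (∣ S ∣ , G ↾ S)
induced≅↾ G S = lemma (elements S) (embed S) (elements≡tabulate S)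
  where
  lemma : ∀ {k} xs (f : Fin k → Fin _) → xs ≡ tabulate f → pullback (lookup xs) G ≅ pullback f G
  lemma xs f ≡.refl = ≅-sym {G = pullback f G} {H = pullback (lookup xs) G}
    ( Perm.cast-id (≡.sym (List.length-tabulate f))
    , λ u v → ≡.sym (≡.cong₂ (adj G) (List.lookup-tabulate f u) (List.lookup-tabulate f v)))

length-subsets : ∀ n → length (subsets n) ≡ 2 ^ n
length-subsets zero    = ≡.refl
length-subsets (suc n) = ≡.trans
  (length-cartesianProductWith Vec._∷_ (outside ∷ inside ∷ []) (subsets n))
  (≡.cong (2 ℕ.*_) (length-subsets n))

C*k!*n! : ∀ k n → ((k ℕ.+ n) C k) ℕ.* (k ! ℕ.* n !) ≡ (k ℕ.+ n) !
C*k!*n! k n = ≡.trans (≡.cong (λ m → ((k ℕ.+ n) C k) ℕ.* (k ! ℕ.* m !)) (≡.sym (ℕ.m+n∸m≡n k n)))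
  (≡.trans (≡.cong (ℕ._* (k ! ℕ.* (k ℕ.+ n ∸ k) !)) (nCk≡n!/k![n-k]! (ℕ.m≤m+n k n)))
           (m/n*n≡m {{k ℕ.!* (k ℕ.+ n ∸ k) !≢0}} (k![n∸k]!∣n! (ℕ.m≤m+n k n))))

module SubsetSums {c ℓ} (R : CommutativeRing c ℓ) where

  open CommutativeRing R hiding (zero)
  open Sums +-monoid using (∑)
  open FiniteSums R
  open Relation.Binary.Reasoning.Setoid setoid

  ∑-bools : ∀ n (f : Subset (suc n) → Carrier) →
    ∑ (subsets (suc n)) f ≈
    ∑ (outside ∷ inside ∷ []) λ b → ∑ (subsets n) λ T → f (b ∷ T)
  ∑-bools n = ∑-cartesianProductWith Vec._∷_ (outside ∷ inside ∷ []) (subsets n)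

  -- A subset of the vertices is a pair of subsets of S and of its complement.
  ∑-restrict : ∀ {n} (S : Subset n) (f : Subset ∣ S ∣ → Subset ∣ ∁ S ∣ → Carrier) →
    ∑ (subsets n) (λ T → f (restrict S T) (restrict (∁ S) T)) ≈
    ∑ (subsets ∣ S ∣) λ U → ∑ (subsets ∣ ∁ S ∣) λ V → f U V
  ∑-restrict []            f = sym (+-identityʳ _)
  ∑-restrict {suc n} (inside  ∷ S) f = begin
    ∑ (subsets (suc n)) (λ T → f (restrict (inside ∷ S) T) (restrict (∁ (inside ∷ S)) T))
      ≈⟨ ∑-bools n _ ⟩
    ∑ bs (λ b → ∑ (subsets n) λ T → f (b ∷ restrict S T) (restrict (∁ S) T))
      ≈⟨ ∑-cong bs (λ b → ∑-restrict S λ U V → f (b ∷ U) V) ⟩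
    ∑ bs (λ b → ∑ (subsets ∣ S ∣) λ U → ∑ (subsets ∣ ∁ S ∣) λ V → f (b ∷ U) V)
      ≈⟨ sym (∑-bools ∣ S ∣ _) ⟩
    ∑ (subsets (suc ∣ S ∣)) (λ U → ∑ (subsets ∣ ∁ S ∣) λ V → f U V) ∎
    where bs = outside ∷ inside ∷ []
  ∑-restrict {suc n} (outside ∷ S) f = begin
    ∑ (subsets (suc n)) (λ T → f (restrict (outside ∷ S) T) (restrict (∁ (outside ∷ S)) T))
      ≈⟨ ∑-bools n _ ⟩
    ∑ bs (λ b → ∑ (subsets n) λ T → f (restrict S T) (b ∷ restrict (∁ S) T))
      ≈⟨ ∑-cong bs (λ b → ∑-restrict S λ U V → f U (b ∷ V)) ⟩
    ∑ bs (λ b → ∑ (subsets ∣ S ∣) λ U → ∑ (subsets ∣ ∁ S ∣) λ V → f U (b ∷ V))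
      ≈⟨ ∑-swap bs (subsets ∣ S ∣) (λ b U → ∑ (subsets ∣ ∁ S ∣) λ V → f U (b ∷ V)) ⟩
    ∑ (subsets ∣ S ∣) (λ U → ∑ bs λ b → ∑ (subsets ∣ ∁ S ∣) λ V → f U (b ∷ V))
      ≈⟨ ∑-cong (subsets ∣ S ∣) (λ U → sym (∑-bools ∣ ∁ S ∣ (f U))) ⟩
    ∑ (subsets ∣ S ∣) (λ U → ∑ (subsets (suc ∣ ∁ S ∣)) λ V → f U V) ∎
    where bs = outside ∷ inside ∷ []

  ∑-subsets-const : ∀ n a → ∑ (subsets n) (λ _ → a) ≈ fromNat (2 ^ n) * a
  ∑-subsets-const n a = trans (∑-const (subsets n) a)
    (*-congʳ (reflexive (≡.cong fromNat (length-subsets n))))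

  fromNat-2^+ : ∀ m n → fromNat (2 ^ m) * fromNat (2 ^ n) ≈ fromNat (2 ^ (m ℕ.+ n))
  fromNat-2^+ m n = trans (sym (fromNat-* (2 ^ m) (2 ^ n)))
    (reflexive (≡.cong fromNat (≡.sym (ℕ.^-distribˡ-+-* 2 m n))))

  ∑-addVertex : ∀ n (f : SimpleGraph (suc n) → Carrier) →
    ∑ (labelledGraphs (suc n)) f ≈
    ∑ (subsets n) λ T → ∑ (labelledGraphs n) λ G → f (addVertex T G)
  ∑-addVertex n = ∑-cartesianProductWith addVertex (subsets n) (labelledGraphs n)

  -- A graph is given by its restrictions to S and to the complement of S and by
  -- a choice of the edges between them.
  ∑-induced : ∀ {n} (S : Subset n) (f : SimpleGraph ∣ S ∣ → SimpleGraph ∣ ∁ S ∣ → Carrier) →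
    (∀ {G G′ H H′} → G ≗ᴳ G′ → H ≗ᴳ H′ → f G H ≈ f G′ H′) →
    ∑ (labelledGraphs n) (λ G → f (G ↾ S) (G ↾ ∁ S)) ≈
    fromNat (2 ^ (∣ S ∣ ℕ.* ∣ ∁ S ∣)) *
      ∑ (labelledGraphs ∣ S ∣) λ G → ∑ (labelledGraphs ∣ ∁ S ∣) λ H → f G H
  ∑-induced [] f f-cong = begin
    f (emptyGraph ↾ []) (emptyGraph ↾ []) + 0#
      ≈⟨ +-congʳ (f-cong (λ ()) (λ ())) ⟩
    f emptyGraph emptyGraph + 0#
      ≈⟨ sym (+-identityʳ _) ⟩
    (f emptyGraph emptyGraph + 0#) + 0#
      ≈⟨ sym (*-identityˡ _) ⟩
    1# * ((f emptyGraph emptyGraph + 0#) + 0#)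
      ≈⟨ *-congʳ (sym fromNat-1) ⟩
    fromNat 1 * ((f emptyGraph emptyGraph + 0#) + 0#) ∎
  ∑-induced {suc n} (inside ∷ S) f f-cong = begin
    ∑ (labelledGraphs (suc n)) (λ G → f (G ↾ (inside ∷ S)) (G ↾ (outside ∷ ∁ S)))
      ≈⟨ ∑-addVertex n _ ⟩
    ∑ (subsets n) (λ T → ∑ (labelledGraphs n) λ G →
      f (addVertex T G ↾ (inside ∷ S)) (addVertex T G ↾ (outside ∷ ∁ S)))
      ≈⟨ ∑-cong (subsets n) (λ T → ∑-cong (labelledGraphs n) λ G →
           f-cong (addVertex-↾ S T G) λ _ _ → ≡.refl) ⟩
    ∑ (subsets n) (λ T → ∑ (labelledGraphs n) λ G →
      f (addVertex (restrict S T) (G ↾ S)) (G ↾ ∁ S))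
      ≈⟨ ∑-cong (subsets n) (λ T → ∑-induced S (λ G H → f (addVertex (restrict S T) G) H)
           λ e → f-cong (addVertex-cong e)) ⟩
    ∑ (subsets n) (λ T → 2^sc * total (restrict S T))
      ≈⟨ ∑-*ˡ (subsets n) _ _ ⟩
    2^sc * ∑ (subsets n) (λ T → total (restrict S T))
      ≈⟨ *-congˡ (∑-restrict S λ U V → total U) ⟩
    2^sc * ∑ (subsets ∣ S ∣) (λ U → ∑ (subsets ∣ ∁ S ∣) λ V → total U)
      ≈⟨ *-congˡ (∑-cong (subsets ∣ S ∣) λ U → ∑-subsets-const ∣ ∁ S ∣ _) ⟩
    2^sc * ∑ (subsets ∣ S ∣) (λ U → fromNat (2 ^ ∣ ∁ S ∣) * total U)
      ≈⟨ *-congˡ (∑-*ˡ (subsets ∣ S ∣) _ _) ⟩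
    2^sc * (fromNat (2 ^ ∣ ∁ S ∣) * ∑ (subsets ∣ S ∣) total)
      ≈⟨ sym (*-assoc _ _ _) ⟩
    2^sc * fromNat (2 ^ ∣ ∁ S ∣) * ∑ (subsets ∣ S ∣) total
      ≈⟨ *-cong (trans (*-comm _ _) (fromNat-2^+ ∣ ∁ S ∣ (∣ S ∣ ℕ.* ∣ ∁ S ∣)))
                (sym (∑-addVertex ∣ S ∣ _)) ⟩
    fromNat (2 ^ (suc ∣ S ∣ ℕ.* ∣ ∁ S ∣)) *
      ∑ (labelledGraphs (suc ∣ S ∣)) (λ G → ∑ (labelledGraphs ∣ ∁ S ∣) λ H → f G H) ∎
    where
    2^sc : Carrier
    2^sc = fromNat (2 ^ (∣ S ∣ ℕ.* ∣ ∁ S ∣))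
    total : Subset ∣ S ∣ → Carrier
    total U = ∑ (labelledGraphs ∣ S ∣) λ G → ∑ (labelledGraphs ∣ ∁ S ∣) λ H → f (addVertex U G) H
  ∑-induced {suc n} (outside ∷ S) f f-cong = begin
    ∑ (labelledGraphs (suc n)) (λ G → f (G ↾ (outside ∷ S)) (G ↾ (inside ∷ ∁ S)))
      ≈⟨ ∑-addVertex n _ ⟩
    ∑ (subsets n) (λ T → ∑ (labelledGraphs n) λ G →
      f (addVertex T G ↾ (outside ∷ S)) (addVertex T G ↾ (inside ∷ ∁ S)))
      ≈⟨ ∑-cong (subsets n) (λ T → ∑-cong (labelledGraphs n) λ G →
           f-cong (λ _ _ → ≡.refl) (addVertex-↾ (∁ S) T G)) ⟩
    ∑ (subsets n) (λ T → ∑ (labelledGraphs n) λ G →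
      f (G ↾ S) (addVertex (restrict (∁ S) T) (G ↾ ∁ S)))
      ≈⟨ ∑-cong (subsets n) (λ T → ∑-induced S (λ G H → f G (addVertex (restrict (∁ S) T) H))
           λ e e′ → f-cong e (addVertex-cong e′)) ⟩
    ∑ (subsets n) (λ T → 2^sc * total (restrict (∁ S) T))
      ≈⟨ ∑-*ˡ (subsets n) _ _ ⟩
    2^sc * ∑ (subsets n) (λ T → total (restrict (∁ S) T))
      ≈⟨ *-congˡ (∑-restrict S λ U V → total V) ⟩
    2^sc * ∑ (subsets ∣ S ∣) (λ U → ∑ (subsets ∣ ∁ S ∣) total)
      ≈⟨ *-congˡ (∑-subsets-const ∣ S ∣ _) ⟩
    2^sc * (fromNat (2 ^ ∣ S ∣) * ∑ (subsets ∣ ∁ S ∣) total)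
      ≈⟨ sym (*-assoc _ _ _) ⟩
    2^sc * fromNat (2 ^ ∣ S ∣) * ∑ (subsets ∣ ∁ S ∣) total
      ≈⟨ *-cong (trans (*-comm _ _) (trans (fromNat-2^+ ∣ S ∣ (∣ S ∣ ℕ.* ∣ ∁ S ∣))
                  (reflexive (≡.cong (λ e → fromNat (2 ^ e)) (≡.sym (ℕ.*-suc ∣ S ∣ ∣ ∁ S ∣))))))
                (∑-swap (subsets ∣ ∁ S ∣) (labelledGraphs ∣ S ∣) _) ⟩
    fromNat (2 ^ (∣ S ∣ ℕ.* suc ∣ ∁ S ∣)) *
      ∑ (labelledGraphs ∣ S ∣) (λ G → ∑ (subsets ∣ ∁ S ∣) λ V →
        ∑ (labelledGraphs ∣ ∁ S ∣) λ H → f G (addVertex V H))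
      ≈⟨ *-congˡ (∑-cong (labelledGraphs ∣ S ∣) λ G → sym (∑-addVertex ∣ ∁ S ∣ (f G))) ⟩
    fromNat (2 ^ (∣ S ∣ ℕ.* suc ∣ ∁ S ∣)) *
      ∑ (labelledGraphs ∣ S ∣) (λ G → ∑ (labelledGraphs (suc ∣ ∁ S ∣)) λ H → f G H) ∎
    where
    2^sc : Carrier
    2^sc = fromNat (2 ^ (∣ S ∣ ℕ.* ∣ ∁ S ∣))
    total : Subset ∣ ∁ S ∣ → Carrier
    total V = ∑ (labelledGraphs ∣ S ∣) λ G → ∑ (labelledGraphs ∣ ∁ S ∣) λ H → f G (addVertex V H)

  -- If h is supported at k, only the n C k subsets of size k contribute.
  ∑-size : ∀ n k (h : ℕ → Carrier) → (∀ j → j ≢ k → h j ≈ 0#) →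
           ∑ (subsets n) (λ S → h ∣ S ∣) ≈ fromNat (n C k) * h k
  ∑-size zero zero    h h≈0 = trans (+-identityʳ _) (sym (trans (*-congʳ fromNat-1) (*-identityˡ _)))
  ∑-size zero (suc k) h h≈0 = trans (trans (+-identityʳ _) (h≈0 0 λ ())) (sym (zeroˡ _))
  ∑-size (suc n) k h h≈0 = begin
    ∑ (subsets (suc n)) (λ S → h ∣ S ∣)
      ≈⟨ ∑-bools n _ ⟩
    ∑ (subsets n) (λ S → h ∣ S ∣) + (∑ (subsets n) (λ S → h (suc ∣ S ∣)) + 0#)
      ≈⟨ +-congˡ (+-identityʳ _) ⟩
    ∑ (subsets n) (λ S → h ∣ S ∣) + ∑ (subsets n) (λ S → h (suc ∣ S ∣))
      ≈⟨ +-congʳ (∑-size n k h h≈0) ⟩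
    fromNat (n C k) * h k + ∑ (subsets n) (λ S → h (suc ∣ S ∣))
      ≈⟨ pascal k h≈0 ⟩
    fromNat (suc n C k) * h k ∎
    where
    pascal : ∀ k → (∀ j → j ≢ k → h j ≈ 0#) →
      fromNat (n C k) * h k + ∑ (subsets n) (λ S → h (suc ∣ S ∣)) ≈ fromNat (suc n C k) * h k
    pascal zero h≈0 = trans (+-congˡ (∑-0 (subsets n) λ S → h≈0 _ λ ())) (+-identityʳ _)
    pascal (suc k) h≈0 = begin
      fromNat (n C suc k) * h (suc k) + ∑ (subsets n) (λ S → h (suc ∣ S ∣))
        ≈⟨ +-congˡ (∑-size n k (h ∘ suc) λ j j≢k → h≈0 (suc j) (j≢k ∘ ℕ.suc-injective)) ⟩
      fromNat (n C suc k) * h (suc k) + fromNat (n C k) * h (suc k)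
        ≈⟨ sym (distribʳ _ _ _) ⟩
      (fromNat (n C suc k) + fromNat (n C k)) * h (suc k)
        ≈⟨ *-congʳ (trans (+-comm _ _) (sym (fromNat-+ (n C k) (n C suc k)))) ⟩
      fromNat (n C k ℕ.+ n C suc k) * h (suc k)
        ≡⟨ ≡.cong (λ b → fromNat b * h (suc k)) (nCk+nC[k+1]≡[n+1]C[k+1] n k) ⟩
      fromNat (suc n C suc k) * h (suc k) ∎

-- Decomposition of disconnected graphs

-- A subset S and its complement partition Fin n: merge S and split S are inverse bijections
-- that respect the order on either part.
merge : ∀ {n} (S : Subset n) → Fin ∣ S ∣ ⊎ Fin ∣ ∁ S ∣ → Fin n
merge S = [ embed S , embed (∁ S) ]′

split : ∀ {n} (S : Subset n) → Fin n → Fin ∣ S ∣ ⊎ Fin ∣ ∁ S ∣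
split (inside  ∷ S) zero    = inj₁ zero
split (inside  ∷ S) (suc k) = Sum.map suc id (split S k)
split (outside ∷ S) zero    = inj₂ zero
split (outside ∷ S) (suc k) = Sum.map id suc (split S k)

merge-split : ∀ {n} (S : Subset n) k → merge S (split S k) ≡ k
merge-split (inside  ∷ S) zero    = ≡.refl
merge-split (inside  ∷ S) (suc k) with split S k | merge-split S k
... | inj₁ _ | e = ≡.cong suc e
... | inj₂ _ | e = ≡.cong suc e
merge-split (outside ∷ S) zero    = ≡.refl
merge-split (outside ∷ S) (suc k) with split S k | merge-split S k
... | inj₁ _ | e = ≡.cong suc e
... | inj₂ _ | e = ≡.cong suc e

split-merge : ∀ {n} (S : Subset n) x → split S (merge S x) ≡ x
split-merge (inside  ∷ S) (inj₁ zero)    = ≡.refl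
split-merge (inside  ∷ S) (inj₁ (suc k)) = ≡.cong (Sum.map suc id) (split-merge S (inj₁ k))
split-merge (inside  ∷ S) (inj₂ k)       = ≡.cong (Sum.map suc id) (split-merge S (inj₂ k))
split-merge (outside ∷ S) (inj₁ k)       = ≡.cong (Sum.map id suc) (split-merge S (inj₁ k))
split-merge (outside ∷ S) (inj₂ zero)    = ≡.refl
split-merge (outside ∷ S) (inj₂ (suc k)) = ≡.cong (Sum.map id suc) (split-merge S (inj₂ k))

embed-inside : ∀ {n} (S : Subset n) k → Vec.lookup S (embed S k) ≡ inside
embed-inside (inside  ∷ S) zero    = ≡.refl
embed-inside (inside  ∷ S) (suc k) = embed-inside S k
embed-inside (outside ∷ S) k       = embed-inside S k

embed-outside : ∀ {n} (S : Subset n) k → Vec.lookup S (embed (∁ S) k) ≡ outside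
embed-outside (inside  ∷ S) k       = embed-outside S k
embed-outside (outside ∷ S) zero    = ≡.refl
embed-outside (outside ∷ S) (suc k) = embed-outside S k

∣∣-nonZero : ∀ {n} (S : Subset n) k → Vec.lookup S k ≡ inside → NonZero ∣ S ∣
∣∣-nonZero (inside  ∷ S) k       e = _
∣∣-nonZero (outside ∷ S) (suc k) e = ∣∣-nonZero S k e

∣∁∣-nonZero : ∀ {n} (S : Subset n) k → Vec.lookup S k ≡ outside → NonZero ∣ ∁ S ∣
∣∁∣-nonZero (outside ∷ S) k       e = _
∣∁∣-nonZero (inside  ∷ S) (suc k) e = ∣∁∣-nonZero S k e

-- A graph without edges between S and its complement is a disjoint union.
separated⇒⊔ : ∀ {n} (G : SimpleGraph n) (S : Subset n) →
  (∀ u v → Vec.lookup S u ≡ inside → Vec.lookup S v ≡ outside → adj G u v ≡ false) →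
  (∣ S ∣ , G ↾ S) ⊔ᴳ (∣ ∁ S ∣ , G ↾ ∁ S) ≅ᴳ (n , G)
separated⇒⊔ {n} G S separated = π , iso
  where
  π : Permutation (∣ S ∣ ℕ.+ ∣ ∁ S ∣) n
  π = Perm.permutation (merge S ∘ splitAt ∣ S ∣) (join ∣ S ∣ ∣ ∁ S ∣ ∘ split S)
    (λ v → ≡.trans (≡.cong (merge S) (Fin.splitAt-join ∣ S ∣ _ (split S v))) (merge-split S v))
    (λ v → ≡.trans (≡.cong (join ∣ S ∣ _) (split-merge S (splitAt ∣ S ∣ v))) (Fin.join-splitAt ∣ S ∣ _ v))

  iso : IsIso (disjointUnion (G ↾ S) (G ↾ ∁ S)) G π
  iso u v with splitAt ∣ S ∣ u | splitAt ∣ S ∣ v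
  ... | inj₁ _ | inj₁ _ = ≡.refl
  ... | inj₂ _ | inj₂ _ = ≡.refl
  ... | inj₁ u | inj₂ v = ≡.sym (separated _ _ (embed-inside S u) (embed-outside S v))
  ... | inj₂ u | inj₁ v = ≡.sym (≡.trans (adj-sym G _ _)
                            (separated _ _ (embed-inside S v) (embed-outside S u)))

module _ {n} (G : SimpleGraph (suc n)) where

  reachable? : ∀ v → Dec (Star (Adj G) zero v)
  reachable? v = map′ (pathVia⇒star G (allFin _)) (star⇒pathVia G) (pathVia? G (allFin _) zero v)

  -- The component of the vertex zero.
  component : Subset (suc n)
  component = Vec.tabulate (does ∘ reachable?)

  component-reachable : ∀ v → Vec.lookup component v ≡ does (reachable? v)
  component-reachable = Vec.lookup∘tabulate (does ∘ reachable?)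

  component-separated : ∀ u v → Vec.lookup component u ≡ inside → Vec.lookup component v ≡ outside →
                        adj G u v ≡ false
  component-separated u v u∈ v∉ = lemma (reachable? u) (reachable? v)
    (≡.trans (≡.sym (component-reachable u)) u∈) (≡.trans (≡.sym (component-reachable v)) v∉)
    where
    lemma : (p : Dec (Star (Adj G) zero u)) (q : Dec (Star (Adj G) zero v)) →
            does p ≡ true → does q ≡ false → adj G u v ≡ false
    lemma (yes p) (no ¬q) _ _ with adj G u v in e
    ... | true  = contradiction (p ◅◅ e ◅ ε) ¬q
    ... | false = ≡.refl

  disconnected⇒unreachable : ¬ Connected G → Σ[ v ∈ Fin (suc n) ] ¬ Star (Adj G) zero v
  disconnected⇒unreachable ¬conn = Fin.¬∀⟶∃¬ (suc n) _ reachable? λ reach →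
    ¬conn (s≤s z≤n , λ u v → reverse (λ {x} {y} e → ≡.trans (adj-sym G y x) e) (reach u) ◅◅ reach v)

  -- A disconnected graph is a disjoint union of two non-empty graphs.
  disconnected⇒⊔ : ¬ Connected G → Σ[ S ∈ Subset (suc n) ]
    NonZero ∣ S ∣ × NonZero ∣ ∁ S ∣ × (∣ S ∣ , G ↾ S) ⊔ᴳ (∣ ∁ S ∣ , G ↾ ∁ S) ≅ᴳ (suc n , G)
  disconnected⇒⊔ ¬conn = let v , unreachable = disconnected⇒unreachable ¬conn in
    component ,
    ∣∣-nonZero component zero (≡.trans (component-reachable zero) (dec-true (reachable? zero) ε)) ,
    ∣∁∣-nonZero component v (≡.trans (component-reachable v) (dec-false (reachable? v) unreachable)) ,
    separated⇒⊔ G component component-separated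

-- Polynomials as functionals, and their derivatives

module Polynomials {c ℓ₁ ℓ₂} (K : HeytingField c ℓ₁ ℓ₂) (char0 : CharacteristicZero K) where

  open HeytingField K using (_#_; #⇒invertible)
  open CommutativeRing (fieldRing K) hiding (zero; refl; sym; trans)
  private module K = CommutativeRing (fieldRing K)
  open Sums +-monoid using (∑)
  open FiniteSums (fieldRing K)
  open Invariants K char0
  open Relation.Binary.Reasoning.Setoid setoid
  open Algebra.Solver.Ring.NaturalCoefficients.Default commutativeSemiring
    using (solve; _:*_; _:+_; _:=_)

  private variable
    A B C : Set

  -- The inverse of x is given as an inverse of x - 0#.
  recip-inverse : ∀ {x} (x#0 : x # 0#) → x * recip x#0 ≈ 1#
  recip-inverse {x} x#0 = K.trans (*-congʳ (K.sym x-0≈x)) (proj₂ (proj₂ (#⇒invertible x#0)))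
    where
    x-0≈x : x - 0# ≈ x
    x-0≈x = begin
      x - 0#        ≈⟨ K.sym (+-identityʳ _) ⟩
      x - 0# + 0#   ≈⟨ +-assoc x (- 0#) 0# ⟩
      x + (- 0# + 0#) ≈⟨ +-congˡ (-‿inverseˡ 0#) ⟩
      x + 0#        ≈⟨ +-identityʳ x ⟩
      x             ∎

  1/-inverse : ∀ n .{{_ : NonZero n}} → ⌜ n ⌝ * 1/ n ≈ 1#
  1/-inverse n = recip-inverse (char0 n)

  ⌜⌝-cancel : ∀ n .{{_ : NonZero n}} {x y} → ⌜ n ⌝ * x ≈ ⌜ n ⌝ * y → x ≈ y
  ⌜⌝-cancel n {x} {y} nx≈ny = begin
    x                  ≈⟨ K.sym (undo x) ⟩
    1/ n * (⌜ n ⌝ * x) ≈⟨ *-congˡ nx≈ny ⟩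
    1/ n * (⌜ n ⌝ * y) ≈⟨ undo y ⟩
    y                  ∎
    where
    undo : ∀ z → 1/ n * (⌜ n ⌝ * z) ≈ z
    undo z = K.trans (K.sym (*-assoc _ _ z))
      (K.trans (*-congʳ (K.trans (*-comm _ _) (1/-inverse n))) (*-identityˡ z))

  -- The linear extension of φ, evaluated at f.
  pair : Free A → (A → Carrier) → Carrier
  pair f φ = ∑ f λ (a , x) → a * φ x

  pair-cong : ∀ (f : Free A) {φ ψ : A → Carrier} → (∀ x → φ x ≈ ψ x) → pair f φ ≈ pair f ψ
  pair-cong f φ≈ψ = ∑-cong f λ (a , x) → *-congˡ (φ≈ψ x)

  pair-0 : ∀ (f : Free A) {φ : A → Carrier} → (∀ x → φ x ≈ 0#) → pair f φ ≈ 0#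
  pair-0 f φ≈0 = ∑-0 f λ (a , x) → K.trans (*-congˡ (φ≈0 x)) (zeroʳ a)

  pair-+ : ∀ (f : Free A) (φ ψ : A → Carrier) → pair f (λ x → φ x + ψ x) ≈ pair f φ + pair f ψ
  pair-+ f φ ψ = K.trans (∑-cong f λ (a , x) → distribˡ a _ _) (∑-+ f _ _)

  pair-*ˡ : ∀ (f : Free A) b (φ : A → Carrier) → pair f (λ x → b * φ x) ≈ b * pair f φ
  pair-*ˡ f b φ = K.trans
    (∑-cong f λ (a , x) → solve 3 (λ a b p → a :* (b :* p) := b :* (a :* p)) K.refl a b (φ x))
    (∑-*ˡ f b _)

  pair-*ʳ : ∀ (f : Free A) (φ : A → Carrier) b → pair f (λ x → φ x * b) ≈ pair f φ * b
  pair-*ʳ f φ b = K.trans (∑-cong f λ (a , x) → K.sym (*-assoc a (φ x) b)) (∑-*ʳ f _ b)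

  pair-++ : ∀ (f g : Free A) φ → pair (f ++ g) φ ≈ pair f φ + pair g φ
  pair-++ f g φ = ∑-++ f g _

  pair-• : ∀ b (f : Free A) φ → pair (b • f) φ ≈ b * pair f φ
  pair-• b f φ = K.trans (∑-map (λ (a , x) → b * a , x) f (λ (a , x) → a * φ x))
    (K.trans (∑-cong f λ (a , x) → *-assoc b a (φ x)) (∑-*ˡ f b _))

  pair-⟨⟩ : ∀ (x : A) φ → pair ⟨ x ⟩ φ ≈ φ x
  pair-⟨⟩ x φ = K.trans (+-identityʳ _) (*-identityˡ _)

  pair-extend : ∀ (h : A → Free B) f φ → pair (extend h f) φ ≈ pair f λ x → pair (h x) φ
  pair-extend h f φ = K.trans
    (∑-concatMap (λ (a , x) → a • h x) f (λ (b , y) → b * φ y))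
    (∑-cong f λ (a , x) → pair-• a (h x) φ)

  pair-bilinear : ∀ (op : A → B → C) f g φ →
    pair (bilinear op f g) φ ≈ pair f λ x → pair g λ y → φ (op x y)
  pair-bilinear op f g φ = K.trans
    (∑-cartesianProductWith (λ (a , x) (b , y) → a * b , op x y) f g (λ (b , y) → b * φ y))
    (∑-cong f λ (a , x) → K.trans (∑-cong g λ (b , y) → *-assoc a b _) (∑-*ˡ g a _))

  pair-⊗ : ∀ (f : Free A) (g : Free B) (φ : A → Carrier) (ψ : B → Carrier) →
    pair (f ⊗ g) (λ (x , y) → φ x * ψ y) ≈ pair f φ * pair g ψ
  pair-⊗ f g φ ψ = K.trans (pair-bilinear _,_ f g _)
    (K.trans (pair-cong f λ x → pair-*ˡ g (φ x) ψ) (pair-*ʳ f φ _))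

  coeff≈pair : ∀ (X : DecSetoid 0ℓ 0ℓ) f x →
    FreeSpace.coeff X f x ≈ pair f λ y → 𝕀 (DecSetoid._≟_ X y x)
  coeff≈pair X []            x = K.refl
  coeff≈pair X ((a , y) ∷ f) x = +-cong (if-𝕀 (y ≟ x) a) (coeff≈pair X f x)
    where open DecSetoid X using (_≟_)

  -- The functional dual to the monomial m.
  δ : Monomial → Monomial → Carrier
  δ m μ = 𝕀 (μ ↭? m)

  δ-refl : ∀ m → δ m m ≈ 1#
  δ-refl m = 𝕀-yes (m ↭? m) ↭-refl

  δ-cong : ∀ m {μ ν} → μ ↭ ν → δ m μ ≈ δ m ν
  δ-cong m {μ} {ν} μ↭ν = 𝕀-cong (μ ↭? m) (ν ↭? m) (↭-trans (↭-sym μ↭ν)) (↭-trans μ↭ν)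

  δ[]-∷ : ∀ k μ → δ [] (k ∷ μ) ≈ 0#
  δ[]-∷ k μ = 𝕀-no (k ∷ μ ↭? []) ¬x∷xs↭[]

  δ[-]-[] : ∀ k → δ [ k ] [] ≈ 0#
  δ[-]-[] k = 𝕀-no ([] ↭? [ k ]) (¬x∷xs↭[] ∘ ↭-sym)

  δ[-]-∷ : ∀ k l μ → δ [ k ] (l ∷ μ) ≈ 𝕀 (l ℕ.≟ k) * δ [] μ
  δ[-]-∷ k l μ = K.trans
    (𝕀-cong (l ∷ μ ↭? [ k ]) (l ℕ.≟ k ×-dec μ ↭? [])
      (λ p → singleton (↭-singleton-inv p)) (λ { (≡.refl , p) → ↭-prep k p }))
    (𝕀-× (l ℕ.≟ k) (μ ↭? []))
    where
    singleton : l ∷ μ ≡ [ k ] → l ≡ k × μ ↭ []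
    singleton ≡.refl = ≡.refl , ↭-refl

  coeff≈pairδ : ∀ f m → coeff f m ≈ pair f (δ m)
  coeff≈pairδ = coeff≈pair monomials

  -- The transpose of the derivation ∂/∂qₖ₊₁: D k φ sends a monomial to the value of the
  -- linear extension of φ at the derivative of that monomial.  Multiplication by qₗ₊₁ becomes
  -- the precomposition with l ∷_, so that the second clause is the Leibniz rule.
  D : ℕ → (Monomial → Carrier) → Monomial → Carrier
  D k φ []      = 0#
  D k φ (l ∷ μ) = 𝕀 (l ℕ.≟ k) * φ μ + D k (φ ∘ (l ∷_)) μ

  pair-comult-∷ : ∀ l μ (φ : Monomial × Monomial → Carrier) → pair (polynomialComult (l ∷ μ)) φ ≈
    pair (polynomialComult μ) (λ (x , y) → φ (l ∷ x , y)) +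
    pair (polynomialComult μ) (λ (x , y) → φ (x , l ∷ y))
  pair-comult-∷ l μ φ = K.trans
    (pair-bilinear (zip _++_ _++_)
      (⟨ [ l ] ⟩ ⊗ ⟨ [] ⟩ ++ ⟨ [] ⟩ ⊗ ⟨ [ l ] ⟩) (polynomialComult μ) φ)
    (+-cong 1*1* (K.trans (+-identityʳ _) 1*1*))
    where
    1*1* : ∀ {x} → (1# * 1#) * x ≈ x
    1*1* = K.trans (*-congʳ (*-identityˡ 1#)) (*-identityˡ _)

  -- The counit law (ε ⊗ id) ∘ Δ = id.
  pair-comult-δ[] : ∀ μ (φ : Monomial → Carrier) →
    pair (polynomialComult μ) (λ (x , y) → δ [] x * φ y) ≈ φ μ
  pair-comult-δ[] [] φ = K.trans (+-identityʳ _)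
    (K.trans (*-congʳ (*-identityˡ 1#)) (K.trans (*-identityˡ _)
      (K.trans (*-congʳ (δ-refl [])) (*-identityˡ _))))
  pair-comult-δ[] (l ∷ μ) φ = K.trans (pair-comult-∷ l μ _)
    (K.trans (+-cong
      (pair-0 (polynomialComult μ) λ (x , y) → K.trans (*-congʳ (δ[]-∷ l x)) (zeroˡ _))
      (pair-comult-δ[] μ (φ ∘ (l ∷_))))
    (+-identityˡ _))

  -- The component of Δ μ in qₖ₊₁ ⊗ - is the derivative of μ.
  pair-comult-δ[-] : ∀ k μ (φ : Monomial → Carrier) →
    pair (polynomialComult μ) (λ (x , y) → δ [ k ] x * φ y) ≈ D k φ μ
  pair-comult-δ[-] k [] φ = K.trans (+-identityʳ _)
    (K.trans (*-congˡ (K.trans (*-congʳ (δ[-]-[] k)) (zeroˡ _))) (zeroʳ _))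
  pair-comult-δ[-] k (l ∷ μ) φ = K.trans (pair-comult-∷ l μ _)
    (+-cong
      (begin
        pair (polynomialComult μ) (λ (x , y) → δ [ k ] (l ∷ x) * φ y)
          ≈⟨ pair-cong (polynomialComult μ) (λ (x , y) → K.trans (*-congʳ (δ[-]-∷ k l x)) (*-assoc _ _ _)) ⟩
        pair (polynomialComult μ) (λ (x , y) → 𝕀 (l ℕ.≟ k) * (δ [] x * φ y))
          ≈⟨ pair-*ˡ (polynomialComult μ) (𝕀 (l ℕ.≟ k)) _ ⟩
        𝕀 (l ℕ.≟ k) * pair (polynomialComult μ) (λ (x , y) → δ [] x * φ y)
          ≈⟨ *-congˡ (pair-comult-δ[] μ φ) ⟩
        𝕀 (l ℕ.≟ k) * φ μ ∎)
      (pair-comult-δ[-] k μ (φ ∘ (l ∷_))))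

  D-cong : ∀ k {φ ψ} → (∀ μ → φ μ ≈ ψ μ) → ∀ μ → D k φ μ ≈ D k ψ μ
  D-cong k φ≈ψ []      = K.refl
  D-cong k φ≈ψ (l ∷ μ) = +-cong (*-congˡ (φ≈ψ μ)) (D-cong k (λ ν → φ≈ψ (l ∷ ν)) μ)

  D-cong-↭ : ∀ k φ → (∀ {μ ν} → μ ↭ ν → φ μ ≈ φ ν) → ∀ {μ ν} → μ ↭ ν → D k φ μ ≈ D k φ ν
  D-cong-↭ k φ φ-cong ↭.refl           = K.refl
  D-cong-↭ k φ φ-cong (↭.prep l p)     = +-cong (*-congˡ (φ-cong p))
    (D-cong-↭ k (φ ∘ (l ∷_)) (λ q → φ-cong (↭.prep l q)) p)
  D-cong-↭ k φ φ-cong (↭.swap {xs = μ} {ys = ν} l l′ p) = begin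
    𝕀 (l ℕ.≟ k) * φ (l′ ∷ μ) + (𝕀 (l′ ℕ.≟ k) * φ (l ∷ μ) + D k (φ ∘ (l ∷_) ∘ (l′ ∷_)) μ)
      ≈⟨ solve 3 (λ a b c → a :+ (b :+ c) := b :+ (a :+ c)) K.refl _ _ _ ⟩
    𝕀 (l′ ℕ.≟ k) * φ (l ∷ μ) + (𝕀 (l ℕ.≟ k) * φ (l′ ∷ μ) + D k (φ ∘ (l ∷_) ∘ (l′ ∷_)) μ)
      ≈⟨ +-cong (*-congˡ (φ-cong (↭.prep l p))) (+-cong (*-congˡ (φ-cong (↭.prep l′ p)))
           (K.trans (D-cong-↭ k (φ ∘ (l ∷_) ∘ (l′ ∷_)) (λ q → φ-cong (↭.prep l (↭.prep l′ q))) p)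
                    (D-cong k (λ _ → φ-cong (↭-swap l l′ ↭-refl)) ν))) ⟩
    𝕀 (l′ ℕ.≟ k) * φ (l ∷ ν) + (𝕀 (l ℕ.≟ k) * φ (l′ ∷ ν) + D k (φ ∘ (l′ ∷_) ∘ (l ∷_)) ν) ∎
  D-cong-↭ k φ φ-cong (↭.trans p q)    = K.trans (D-cong-↭ k φ φ-cong p) (D-cong-↭ k φ φ-cong q)

  -- Only the monomials obtained from μ by removing k occur in its derivative.
  D-0 : ∀ k φ μ → (∀ ν → k ∷ ν ↭ μ → φ ν ≈ 0#) → D k φ μ ≈ 0#
  D-0 k φ []      φ≈0 = K.refl
  D-0 k φ (l ∷ μ) φ≈0 = K.trans
    (+-cong (K.trans (𝕀-*-cong (l ℕ.≟ k) λ { ≡.refl → φ≈0 μ ↭-refl }) (zeroʳ _))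
            (D-0 k (φ ∘ (l ∷_)) μ λ ν p → φ≈0 (l ∷ ν) (↭-trans (↭-swap k l ↭-refl) (↭-prep l p))))
    (+-identityˡ 0#)

  Natural : Carrier → Set _
  Natural x = ∃[ t ] x ≈ ⌜ t ⌝

  𝕀-natural : ∀ {P : Set} (d : Dec P) → Natural (𝕀 d)
  𝕀-natural (yes _) = 1 , K.sym fromNat-1
  𝕀-natural (no _)  = 0 , K.refl

  D-natural : ∀ k φ → (∀ μ → Natural (φ μ)) → ∀ μ → Natural (D k φ μ)
  D-natural k φ φ-nat []      = 0 , K.refl
  D-natural k φ φ-nat (l ∷ μ) =
    let s , s≡ = 𝕀-natural (l ℕ.≟ k)
        t , t≡ = φ-nat μ
        u , u≡ = D-natural k (φ ∘ (l ∷_)) (λ ν → φ-nat (l ∷ ν)) μ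
    in s ℕ.* t ℕ.+ u , K.trans
      (+-cong (K.trans (*-cong s≡ t≡) (K.sym (fromNat-* s t))) u≡) (K.sym (fromNat-+ (s ℕ.* t) u))

  private
    D-δ-natural : ∀ k m → Natural (D k (δ m ∘ (k ∷_)) m)
    D-δ-natural k m = D-natural k (δ m ∘ (k ∷_)) (λ μ → 𝕀-natural (k ∷ μ ↭? m)) m

  -- The number of occurrences of k in m: removing any one of them and multiplying by qₖ₊₁
  -- gives m back.
  multiplicity : ℕ → Monomial → ℕ
  multiplicity k m = proj₁ (D-δ-natural k m)

  -- The coefficient of m in a derivative is a multiple of the coefficient of k ∷ m.
  D-δ : ∀ k m μ → D k (δ m) μ ≈ ⌜ suc (multiplicity k m) ⌝ * δ (k ∷ m) μ
  D-δ k m μ = lemma (μ ↭? (k ∷ m))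
    where
    lemma : (d : Dec (μ ↭ k ∷ m)) → D k (δ m) μ ≈ ⌜ suc (multiplicity k m) ⌝ * 𝕀 d
    lemma (yes p) = begin
      D k (δ m) μ
        ≈⟨ D-cong-↭ k (δ m) (δ-cong m) p ⟩
      𝕀 (k ℕ.≟ k) * δ m m + D k (δ m ∘ (k ∷_)) m
        ≈⟨ +-cong (K.trans (*-cong (𝕀-yes (k ℕ.≟ k) ≡.refl) (δ-refl m)) (*-identityˡ 1#))
                  (proj₂ (D-δ-natural k m)) ⟩
      1# + ⌜ multiplicity k m ⌝
        ≈⟨ K.sym (*-identityʳ _) ⟩
      ⌜ suc (multiplicity k m) ⌝ * 1# ∎
    lemma (no ¬p) = K.trans
      (D-0 k (δ m) μ λ ν p → 𝕀-no (ν ↭? m) λ q → ¬p (↭-trans (↭-sym p) (↭-prep k q)))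
      (K.sym (zeroʳ _))

  pair-Dδ : ∀ k m f → pair f (D k (δ m)) ≈ ⌜ suc (multiplicity k m) ⌝ * coeff f (k ∷ m)
  pair-Dδ k m f = K.trans (pair-cong f (D-δ k m))
    (K.trans (pair-*ˡ f _ (δ (k ∷ m))) (*-congˡ (K.sym (coeff≈pairδ f (k ∷ m)))))

-- Derivatives of the one-part Schur polynomials

module Schur {c ℓ₁ ℓ₂} (K : HeytingField c ℓ₁ ℓ₂) (char0 : CharacteristicZero K) where

  open CommutativeRing (fieldRing K) hiding (zero; refl; sym; trans)
  private module K = CommutativeRing (fieldRing K)
  open Sums +-monoid using (∑<)
  open FiniteSums (fieldRing K)
  open Invariants K char0
  open Polynomials K char0
  open Relation.Binary.Reasoning.Setoid setoid
  open Algebra.Solver.Ring.NaturalCoefficients.Default commutativeSemiring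
    using (solve; _:*_; _:+_; _:=_)

  -- The sequence a delayed by k, that is, multiplied by xᵏ as a power series.
  shift : ℕ → (ℕ → Carrier) → ℕ → Carrier
  shift zero    a n       = a n
  shift (suc k) a zero    = 0#
  shift (suc k) a (suc n) = shift k a n

  shift-≤ : ∀ k a {n} → k ≤ n → shift k a n ≡ a (n ∸ k)
  shift-≤ zero    a k≤n       = ≡.refl
  shift-≤ (suc k) a (s≤s k≤n) = shift-≤ k a k≤n

  shift-> : ∀ k a {n} → n < k → shift k a n ≡ 0#
  shift-> (suc k) a {zero}  _         = ≡.refl
  shift-> (suc k) a {suc n} (s≤s n<k) = shift-> k a n<k

  shift-cong : ∀ k {a b : ℕ → Carrier} → (∀ n → a n ≈ b n) → ∀ n → shift k a n ≈ shift k b n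
  shift-cong zero    a≈b n       = a≈b n
  shift-cong (suc k) a≈b zero    = K.refl
  shift-cong (suc k) a≈b (suc n) = shift-cong k a≈b n

  shift-* : ∀ k b a n → shift k (λ n → b * a n) n ≈ b * shift k a n
  shift-* zero    b a n       = K.refl
  shift-* (suc k) b a zero    = K.sym (zeroʳ b)
  shift-* (suc k) b a (suc n) = shift-* k b a n

  shift-∘suc : ∀ k a → a 0 ≈ 0# → ∀ n → shift (suc k) (a ∘ suc) n ≈ shift k a n
  shift-∘suc zero    a a0≈0 zero    = K.sym a0≈0
  shift-∘suc zero    a a0≈0 (suc n) = K.refl
  shift-∘suc (suc k) a a0≈0 zero    = K.refl
  shift-∘suc (suc k) a a0≈0 (suc n) = shift-∘suc k a a0≈0 n

  -- Convolutions commute with delays.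
  ∑<-shift : ∀ k (a : ℕ → ℕ → Carrier) n →
    ∑< (suc n) (λ l → shift k (a l) (n ∸ l)) ≈
    shift k (λ n → ∑< (suc n) λ l → a l (n ∸ l)) n
  ∑<-shift zero    a n       = K.refl
  ∑<-shift (suc k) a zero    = +-identityˡ 0#
  ∑<-shift (suc k) a (suc n) = begin
    ∑< (suc n) (λ l → shift (suc k) (a l) (suc n ∸ l)) + shift (suc k) (a (suc n)) (n ∸ n)
      ≈⟨ +-cong (∑<-cong (suc n) λ { l (s≤s l≤n) →
                  reflexive (≡.cong (shift (suc k) (a l)) (ℕ.+-∸-assoc 1 l≤n)) })
                (reflexive (≡.cong (shift (suc k) (a (suc n))) (ℕ.n∸n≡0 n))) ⟩
    ∑< (suc n) (λ l → shift k (a l) (n ∸ l)) + 0#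
      ≈⟨ +-identityʳ _ ⟩
    ∑< (suc n) (λ l → shift k (a l) (n ∸ l))
      ≈⟨ ∑<-shift k a n ⟩
    shift k (λ n → ∑< (suc n) λ l → a l (n ∸ l)) n ∎

  ∑<-𝕀-shift : ∀ k (a : ℕ → Carrier) n →
    ∑< (suc n) (λ l → 𝕀 (l ℕ.≟ k) * a (n ∸ l)) ≈ shift k a n
  ∑<-𝕀-shift k a n with k ℕ.≤? n
  ... | yes k≤n = K.trans (∑<-𝕀 (suc n) k (s≤s k≤n)) (reflexive (≡.sym (shift-≤ k a k≤n)))
  ... | no  k≰n = K.trans
    (∑<-0 (suc n) λ { l (s≤s l≤n) → K.trans
      (*-congʳ (𝕀-no (l ℕ.≟ k) λ { ≡.refl → k≰n l≤n })) (zeroˡ _) })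
    (reflexive (≡.sym (shift-> k a (ℕ.≰⇒> k≰n))))

  pair-∑< : ∀ n (f : ℕ → Polynomial) φ → pair (∑P.∑< n f) φ ≈ ∑< n λ k → pair (f k) φ
  pair-∑< zero    f φ = K.refl
  pair-∑< (suc n) f φ = K.trans (pair-++ (∑P.∑< n f) (f n) φ) (+-congʳ (pair-∑< n f φ))

  -- The value of (the linear extension of) φ at the component of degree n of (∑ₖ pₖ/k)ʲ.
  powers : ℕ → ℕ → (Monomial → Carrier) → Carrier
  powers j n φ = pair (powˢ powerSums j n) φ

  powers-suc-term : ∀ l g φ →
    pair (powerSums (suc l) ·ᴾ g) φ ≈ 1/ (suc l) * pair g (φ ∘ (l ∷_))
  powers-suc-term l g φ = K.trans (pair-bilinear _++_ (powerSums (suc l)) g φ) (+-identityʳ _)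

  powers-suc-0 : ∀ j φ → powers (suc j) 0 φ ≈ 0#
  powers-suc-0 j φ = K.refl

  powers-suc-suc : ∀ j n φ → powers (suc j) (suc n) φ ≈
    ∑< (suc n) λ l → 1/ (suc l) * powers j (n ∸ l) (φ ∘ (l ∷_))
  powers-suc-suc j n φ = begin
    powers (suc j) (suc n) φ
      ≈⟨ pair-∑< (suc (suc n)) (λ k → powerSums k ·ᴾ powˢ powerSums j (suc n ∸ k)) φ ⟩
    ∑< (suc (suc n)) (λ k → pair (powerSums k ·ᴾ powˢ powerSums j (suc n ∸ k)) φ)
      ≈⟨ ∑<-head (suc n) _ ⟩
    0# + ∑< (suc n) (λ l → pair (powerSums (suc l) ·ᴾ powˢ powerSums j (n ∸ l)) φ)
      ≈⟨ +-identityˡ _ ⟩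
    ∑< (suc n) (λ l → pair (powerSums (suc l) ·ᴾ powˢ powerSums j (n ∸ l)) φ)
      ≈⟨ ∑<-cong (suc n) (λ l _ → powers-suc-term l (powˢ powerSums j (n ∸ l)) φ) ⟩
    ∑< (suc n) (λ l → 1/ (suc l) * powers j (n ∸ l) (φ ∘ (l ∷_))) ∎

  powers-vanish : ∀ j n φ → n < j → powers j n φ ≈ 0#
  powers-vanish (suc j) zero    φ _         = powers-suc-0 j φ
  powers-vanish (suc j) (suc n) φ (s≤s n<j) = K.trans (powers-suc-suc j n φ)
    (∑<-0 (suc n) λ l _ → K.trans
      (*-congˡ (powers-vanish j (n ∸ l) _ (ℕ.≤-<-trans (ℕ.m∸n≤m n l) n<j))) (zeroʳ _))

  powers-zero : ∀ n φ → φ [] ≈ 0# → powers 0 n φ ≈ 0#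
  powers-zero zero    φ φ[]≈0 = K.trans (pair-⟨⟩ [] φ) φ[]≈0
  powers-zero (suc n) φ φ[]≈0 = K.refl

  -- For f = ∑ₖ pₖ/k, the derivative of fʲ⁺¹ by pₖ₊₁ is (j + 1) fʲ / (k + 1), by the Leibniz rule
  -- for f · fʲ.  It lowers the degree by k + 1, which is the delay on the right.
  powers-D : ∀ k j φ n →
    powers (suc j) n (D k φ) ≈ (⌜ suc j ⌝ * 1/ (suc k)) * shift (suc k) (λ n → powers j n φ) n
  powers-D k j φ zero    = K.trans (powers-suc-0 j (D k φ)) (K.sym (zeroʳ _))
  powers-D k j φ (suc n) = begin
    powers (suc j) (suc n) (D k φ)
      ≈⟨ powers-suc-suc j n (D k φ) ⟩
    ∑< (suc n) (λ l → 1/ (suc l) * powers j (n ∸ l) (λ μ → 𝕀 (l ℕ.≟ k) * φ μ + D k (φ ∘ (l ∷_)) μ))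
      ≈⟨ ∑<-cong (suc n) (λ l _ → leibniz l) ⟩
    ∑< (suc n) (λ l → 1/ (suc k) * (𝕀 (l ℕ.≟ k) * powers j (n ∸ l) φ) +
                      1/ (suc l) * powers j (n ∸ l) (D k (φ ∘ (l ∷_))))
      ≈⟨ ∑<-+ (suc n) _ _ ⟩
    ∑< (suc n) (λ l → 1/ (suc k) * (𝕀 (l ℕ.≟ k) * powers j (n ∸ l) φ)) +
    ∑< (suc n) (λ l → 1/ (suc l) * powers j (n ∸ l) (D k (φ ∘ (l ∷_))))
      ≈⟨ +-cong (K.trans (∑<-*ˡ (suc n) _ _) (*-congˡ (∑<-𝕀-shift k (λ n → powers j n φ) n)))
                (rest j) ⟩
    1/ (suc k) * X + (⌜ j ⌝ * 1/ (suc k)) * X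
      ≈⟨ solve 3 (λ r t x → r :* x :+ (t :* r) :* x := r :* x :+ t :* (r :* x)) K.refl _ _ _ ⟩
    1/ (suc k) * X + ⌜ j ⌝ * (1/ (suc k) * X)
      ≈⟨ +-congʳ (K.sym (*-identityˡ _)) ⟩
    1# * (1/ (suc k) * X) + ⌜ j ⌝ * (1/ (suc k) * X)
      ≈⟨ K.sym (distribʳ _ _ _) ⟩
    ⌜ suc j ⌝ * (1/ (suc k) * X)
      ≈⟨ K.sym (*-assoc _ _ _) ⟩
    (⌜ suc j ⌝ * 1/ (suc k)) * X ∎
    where
    X : Carrier
    X = shift k (λ n → powers j n φ) n

    leibniz : ∀ l →
      1/ (suc l) * powers j (n ∸ l) (λ μ → 𝕀 (l ℕ.≟ k) * φ μ + D k (φ ∘ (l ∷_)) μ) ≈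
      1/ (suc k) * (𝕀 (l ℕ.≟ k) * powers j (n ∸ l) φ) +
      1/ (suc l) * powers j (n ∸ l) (D k (φ ∘ (l ∷_)))
    leibniz l = begin
      1/ (suc l) * powers j (n ∸ l) (λ μ → 𝕀 (l ℕ.≟ k) * φ μ + D k (φ ∘ (l ∷_)) μ)
        ≈⟨ *-congˡ (K.trans (pair-+ (powˢ powerSums j (n ∸ l)) _ _)
                            (+-congʳ (pair-*ˡ (powˢ powerSums j (n ∸ l)) _ φ))) ⟩
      1/ (suc l) * (𝕀 (l ℕ.≟ k) * powers j (n ∸ l) φ + powers j (n ∸ l) (D k (φ ∘ (l ∷_))))
        ≈⟨ distribˡ _ _ _ ⟩
      1/ (suc l) * (𝕀 (l ℕ.≟ k) * powers j (n ∸ l) φ) + _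
        ≈⟨ +-congʳ (solve 3 (λ r i p → r :* (i :* p) := i :* (r :* p)) K.refl _ _ _) ⟩
      𝕀 (l ℕ.≟ k) * (1/ (suc l) * powers j (n ∸ l) φ) + _
        ≈⟨ +-congʳ (𝕀-*-cong (l ℕ.≟ k) λ { ≡.refl → K.refl }) ⟩
      𝕀 (l ℕ.≟ k) * (1/ (suc k) * powers j (n ∸ l) φ) + _
        ≈⟨ +-congʳ (solve 3 (λ r i p → i :* (r :* p) := r :* (i :* p)) K.refl _ _ _) ⟩
      1/ (suc k) * (𝕀 (l ℕ.≟ k) * powers j (n ∸ l) φ) +
      1/ (suc l) * powers j (n ∸ l) (D k (φ ∘ (l ∷_))) ∎

    -- The terms in which the derivative hits fʲ.
    rest : ∀ j → ∑< (suc n) (λ l → 1/ (suc l) * powers j (n ∸ l) (D k (φ ∘ (l ∷_)))) ≈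
                 (⌜ j ⌝ * 1/ (suc k)) * shift k (λ n → powers j n φ) n
    rest zero = K.trans
      (∑<-0 (suc n) λ l _ → K.trans (*-congˡ (powers-zero (n ∸ l) (D k (φ ∘ (l ∷_))) K.refl)) (zeroʳ _))
      (K.sym (K.trans (*-congʳ (zeroˡ _)) (zeroˡ _)))
    rest (suc j) = begin
      ∑< (suc n) (λ l → 1/ (suc l) * powers (suc j) (n ∸ l) (D k (φ ∘ (l ∷_))))
        ≈⟨ ∑<-cong (suc n) (λ l _ → *-congˡ (powers-D k j (φ ∘ (l ∷_)) (n ∸ l))) ⟩
      ∑< (suc n) (λ l → 1/ (suc l) * (b * shift (suc k) (λ n → powers j n (φ ∘ (l ∷_))) (n ∸ l)))
        ≈⟨ ∑<-cong (suc n) (λ l _ → K.trans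
             (solve 3 (λ r b x → r :* (b :* x) := b :* (r :* x)) K.refl _ _ _)
             (*-congˡ (K.sym (shift-* (suc k) (1/ (suc l)) _ (n ∸ l))))) ⟩
      ∑< (suc n) (λ l → b * shift (suc k) (λ n → 1/ (suc l) * powers j n (φ ∘ (l ∷_))) (n ∸ l))
        ≈⟨ ∑<-*ˡ (suc n) b _ ⟩
      b * ∑< (suc n) (λ l → shift (suc k) (λ n → 1/ (suc l) * powers j n (φ ∘ (l ∷_))) (n ∸ l))
        ≈⟨ *-congˡ (∑<-shift (suc k) (λ l n → 1/ (suc l) * powers j n (φ ∘ (l ∷_))) n) ⟩
      b * shift (suc k) (λ n → ∑< (suc n) λ l → 1/ (suc l) * powers j (n ∸ l) (φ ∘ (l ∷_))) n
        ≈⟨ *-congˡ (shift-cong (suc k) (λ n → K.sym (powers-suc-suc j n φ)) n) ⟩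
      b * shift (suc k) (λ n → powers (suc j) (suc n) φ) n
        ≈⟨ *-congˡ (shift-∘suc k (λ n → powers (suc j) n φ) (powers-suc-0 j φ) n) ⟩
      b * shift k (λ n → powers (suc j) n φ) n ∎
      where
      b : Carrier
      b = ⌜ suc j ⌝ * 1/ (suc k)

  1/! : ℕ → Carrier
  1/! j = 1/ (j !) {{ℕ._!≢0 j}}

  1/!-suc : ∀ j → 1/! (suc j) * ⌜ suc j ⌝ ≈ 1/! j
  1/!-suc j = ⌜⌝-cancel (suc j !) {{ℕ._!≢0 (suc j)}} (begin
    ⌜ suc j ! ⌝ * (1/! (suc j) * ⌜ suc j ⌝)
      ≈⟨ K.sym (*-assoc _ _ _) ⟩
    ⌜ suc j ! ⌝ * 1/! (suc j) * ⌜ suc j ⌝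
      ≈⟨ *-congʳ (1/-inverse (suc j !) {{ℕ._!≢0 (suc j)}}) ⟩
    1# * ⌜ suc j ⌝
      ≈⟨ *-comm _ _ ⟩
    ⌜ suc j ⌝ * 1#
      ≈⟨ *-congˡ (K.sym (1/-inverse (j !) {{ℕ._!≢0 j}})) ⟩
    ⌜ suc j ⌝ * (⌜ j ! ⌝ * 1/! j)
      ≈⟨ K.sym (*-assoc _ _ _) ⟩
    ⌜ suc j ⌝ * ⌜ j ! ⌝ * 1/! j
      ≈⟨ *-congʳ (K.sym (fromNat-* (suc j) (j !))) ⟩
    ⌜ suc j ! ⌝ * 1/! j ∎)

  pair-schur : ∀ n φ → pair (schur n) φ ≈ ∑< (suc n) λ j → 1/! j * powers j n φ
  pair-schur n φ = K.trans (pair-∑< (suc n) (λ j → 1/! j • powˢ powerSums j n) φ)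
    (∑<-cong (suc n) λ j _ → pair-• (1/! j) (powˢ powerSums j n) φ)

  pair-schur-D : ∀ k φ n → pair (schur n) (D k φ) ≈
    ∑< n λ j → 1/ (suc k) * (1/! j * shift (suc k) (λ n → powers j n φ) n)
  pair-schur-D k φ n = begin
    pair (schur n) (D k φ)
      ≈⟨ pair-schur n (D k φ) ⟩
    ∑< (suc n) (λ j → 1/! j * powers j n (D k φ))
      ≈⟨ ∑<-head n _ ⟩
    1/! 0 * powers 0 n (D k φ) + ∑< n (λ j → 1/! (suc j) * powers (suc j) n (D k φ))
      ≈⟨ K.trans (+-congʳ (K.trans (*-congˡ (powers-zero n (D k φ) K.refl)) (zeroʳ _))) (+-identityˡ _) ⟩
    ∑< n (λ j → 1/! (suc j) * powers (suc j) n (D k φ))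
      ≈⟨ ∑<-cong n (λ j _ → K.trans (*-congˡ (powers-D k j φ n)) (K.trans
           (solve 4 (λ f s r x → f :* ((s :* r) :* x) := r :* ((f :* s) :* x)) K.refl _ _ _ _)
           (*-congˡ (*-congʳ (1/!-suc j))))) ⟩
    ∑< n (λ j → 1/ (suc k) * (1/! j * shift (suc k) (λ n → powers j n φ) n)) ∎

  -- For s = ∑ₙ sₙ, the derivative of s by pₖ₊₁ is s / (k + 1); in degree n it comes from
  -- the component of degree k + 1 + n.
  schur-D : ∀ k φ n → pair (schur (suc k ℕ.+ n)) (D k φ) ≈ 1/ (suc k) * pair (schur n) φ
  schur-D k φ n = begin
    pair (schur (suc k ℕ.+ n)) (D k φ)
      ≈⟨ pair-schur-D k φ (suc k ℕ.+ n) ⟩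
    ∑< (suc k ℕ.+ n) (λ j → 1/ (suc k) * (1/! j * shift (suc k) (λ n → powers j n φ) (suc k ℕ.+ n)))
      ≈⟨ ∑<-*ˡ (suc k ℕ.+ n) _ _ ⟩
    1/ (suc k) * ∑< (suc k ℕ.+ n) (λ j → 1/! j * shift (suc k) (λ n → powers j n φ) (suc k ℕ.+ n))
      ≈⟨ *-congˡ (∑<-cong (suc k ℕ.+ n) λ j _ → *-congˡ (reflexive (≡.trans
           (shift-≤ (suc k) (λ n → powers j n φ) (ℕ.m≤m+n (suc k) n))
           (≡.cong (λ n → powers j n φ) (ℕ.m+n∸m≡n k n))))) ⟩
    1/ (suc k) * ∑< (suc k ℕ.+ n) (λ j → 1/! j * powers j n φ)
      ≡⟨ ≡.cong (λ m → 1/ (suc k) * ∑< m λ j → 1/! j * powers j n φ) (≡.sym (ℕ.+-suc k n)) ⟩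
    1/ (suc k) * ∑< (k ℕ.+ suc n) (λ j → 1/! j * powers j n φ)
      ≈⟨ *-congˡ (∑<-truncate k (suc n) λ j n<j →
           K.trans (*-congˡ (powers-vanish j n φ n<j)) (zeroʳ _)) ⟩
    1/ (suc k) * ∑< (suc n) (λ j → 1/! j * powers j n φ)
      ≈⟨ *-congˡ (K.sym (pair-schur n φ)) ⟩
    1/ (suc k) * pair (schur n) φ ∎

  schur-D-0 : ∀ k φ {n} → n ≤ k → pair (schur n) (D k φ) ≈ 0#
  schur-D-0 k φ {n} n≤k = K.trans (pair-schur-D k φ n) (∑<-0 n λ j _ → K.trans
    (*-congˡ (K.trans (*-congˡ (reflexive (shift-> (suc k) (λ n → powers j n φ) (s≤s n≤k)))) (zeroʳ _)))
    (zeroʳ _))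

  schur-suc-δ[] : ∀ n → pair (schur (suc n)) (δ []) ≈ 0#
  schur-suc-δ[] n = K.trans (pair-schur (suc n) (δ [])) (∑<-0 (suc (suc n)) λ j _ →
    K.trans (*-congˡ (powers≈0 j)) (zeroʳ _))
    where
    powers≈0 : ∀ j → powers j (suc n) (δ []) ≈ 0#
    powers≈0 zero    = K.refl
    powers≈0 (suc j) = K.trans (powers-suc-suc j n (δ [])) (∑<-0 (suc n) λ l _ →
      K.trans (*-congˡ (pair-0 (powˢ powerSums j (n ∸ l)) (δ[]-∷ l))) (zeroʳ _))

  schur-0-δ[] : pair (schur 0) (δ []) ≈ 1#
  schur-0-δ[] = begin
    pair (schur 0) (δ [])
      ≈⟨ pair-schur 0 (δ []) ⟩
    0# + 1/! 0 * powers 0 0 (δ [])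
      ≈⟨ +-identityˡ _ ⟩
    1/! 0 * powers 0 0 (δ [])
      ≈⟨ *-congˡ (K.trans (pair-⟨⟩ [] (δ [])) (K.trans (δ-refl []) (K.sym fromNat-1))) ⟩
    1/! 0 * ⌜ 1 ⌝
      ≈⟨ K.trans (*-comm _ _) (1/-inverse 1) ⟩
    1# ∎

-- Umbral invariants summed over all graphs

-- The numbers n(n-1)/2, defined without division.
triangle : ℕ → ℕ
triangle zero    = 0
triangle (suc n) = n ℕ.+ triangle n

triangle-*2 : ∀ n → triangle n ℕ.* 2 ≡ n ℕ.* (n ∸ 1)
triangle-*2 zero          = ≡.refl
triangle-*2 (suc zero)    = ≡.refl
triangle-*2 (suc (suc n)) = ≡.trans (ℕ.*-distribʳ-+ 2 (suc n) (triangle (suc n)))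
  (≡.trans (≡.cong (suc n ℕ.* 2 ℕ.+_) (triangle-*2 (suc n))) (arith n))
  where
  arith : ∀ n → suc n ℕ.* 2 ℕ.+ suc n ℕ.* n ≡ suc (suc n) ℕ.* suc n
  arith = solve-∀

triangle-+ : ∀ m n → triangle (m ℕ.+ n) ≡ triangle m ℕ.+ triangle n ℕ.+ m ℕ.* n
triangle-+ zero    n = ≡.sym (ℕ.+-identityʳ _)
triangle-+ (suc m) n = ≡.trans (≡.cong (m ℕ.+ n ℕ.+_) (triangle-+ m n)) (arith m n (triangle m) (triangle n))
  where
  arith : ∀ m n s t → m ℕ.+ n ℕ.+ (s ℕ.+ t ℕ.+ m ℕ.* n) ≡ m ℕ.+ s ℕ.+ t ℕ.+ (n ℕ.+ m ℕ.* n)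
  arith = solve-∀

module GeneratingFunction {c ℓ₁ ℓ₂} (K : HeytingField c ℓ₁ ℓ₂) (char0 : CharacteristicZero K) where

  open HeytingField K using (_#_)
  open CommutativeRing (fieldRing K) hiding (zero; refl; sym; trans)
  private module K = CommutativeRing (fieldRing K)
  open Sums +-monoid using (∑)
  open FiniteSums (fieldRing K)
  open GraphSums (fieldRing K)
  open SubsetSums (fieldRing K)
  open Invariants K char0
  open Polynomials K char0
  open Schur K char0
  open Relation.Binary.Reasoning.Setoid setoid
  open Algebra.Solver.Ring.NaturalCoefficients.Default commutativeSemiring
    using (solve; _:*_; _:+_; _:=_)
  private
    module G = BasedHopfAlgebra graphAlgebra
    module P = BasedHopfAlgebra polynomialAlgebra

  pairs≡triangle : ∀ n → pairs n ≡ triangle n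
  pairs≡triangle n = ≡.trans (≡.cong (_/ 2) (≡.sym (triangle-*2 n))) (m*n/n≡m (triangle n) 2)

  2^pairs-+ : ∀ m n →
    ⌜ 2 ^ pairs m ⌝ * ⌜ 2 ^ (m ℕ.* n) ⌝ * ⌜ 2 ^ pairs n ⌝ ≈ ⌜ 2 ^ pairs (m ℕ.+ n) ⌝
  2^pairs-+ m n = begin
    ⌜ 2 ^ pairs m ⌝ * ⌜ 2 ^ (m ℕ.* n) ⌝ * ⌜ 2 ^ pairs n ⌝
      ≈⟨ K.trans (*-congʳ (fromNat-2^+ (pairs m) (m ℕ.* n))) (fromNat-2^+ (pairs m ℕ.+ m ℕ.* n) (pairs n)) ⟩
    ⌜ 2 ^ (pairs m ℕ.+ m ℕ.* n ℕ.+ pairs n) ⌝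
      ≡⟨ ≡.cong (λ e → ⌜ 2 ^ e ⌝) exponents ⟩
    ⌜ 2 ^ pairs (m ℕ.+ n) ⌝ ∎
    where
    arith : ∀ s p t → s ℕ.+ p ℕ.+ t ≡ s ℕ.+ t ℕ.+ p
    arith = solve-∀
    exponents : pairs m ℕ.+ m ℕ.* n ℕ.+ pairs n ≡ pairs (m ℕ.+ n)
    exponents = ≡.trans
      (≡.cong₂ (λ s t → s ℕ.+ m ℕ.* n ℕ.+ t) (pairs≡triangle m) (pairs≡triangle n))
      (≡.trans (arith (triangle m) (m ℕ.* n) (triangle n))
        (≡.trans (≡.sym (triangle-+ m n)) (≡.sym (pairs≡triangle (m ℕ.+ n)))))

  coeff-∑P : ∀ {A : Set} (xs : List A) (f : A → Polynomial) m →
    coeff (∑P.∑ xs f) m ≈ ∑ xs λ x → coeff (f x) m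
  coeff-∑P []       f m = K.refl
  coeff-∑P (x ∷ xs) f m = K.trans (P.coeff-++ (f x) _ m) (+-congˡ (coeff-∑P xs f m))

  -- Rescaling the variables multiplies the monomial m by this factor.
  factor : (∀ n .{{_ : NonZero n}} → Carrier) → Monomial → Carrier
  factor c = foldr (λ k a → c (suc k) * a) 1#

  factor-cong : ∀ (c : ∀ n .{{_ : NonZero n}} → Carrier) {μ ν} → μ ↭ ν → factor c μ ≈ factor c ν
  factor-cong c ↭.refl         = K.refl
  factor-cong c (↭.prep k p)   = *-congˡ (factor-cong c p)
  factor-cong c (↭.swap k l p) = K.trans (*-congˡ (*-congˡ (factor-cong c p)))
    (solve 3 (λ a b x → a :* (b :* x) := b :* (a :* x)) K.refl _ _ _)
  factor-cong c (↭.trans p q)  = K.trans (factor-cong c p) (factor-cong c q)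

  coeff-rescale : ∀ (c : ∀ n .{{_ : NonZero n}} → Carrier) f m →
    coeff (rescale c f) m ≈ factor c m * coeff f m
  coeff-rescale c f m = begin
    coeff (rescale c f) m
      ≈⟨ coeff≈pairδ (rescale c f) m ⟩
    pair (rescale c f) (δ m)
      ≈⟨ pair-extend (λ μ → [ (factor c μ , μ) ]) f (δ m) ⟩
    pair f (λ μ → factor c μ * δ m μ + 0#)
      ≈⟨ pair-cong f (λ μ → K.trans (+-identityʳ _) (K.trans (*-comm _ _)
           (K.trans (𝕀-*-cong (μ ↭? m) (factor-cong c)) (*-comm _ _)))) ⟩
    pair f (λ μ → factor c m * δ m μ)
      ≈⟨ pair-*ˡ f (factor c m) (δ m) ⟩
    factor c m * pair f (δ m)
      ≈⟨ *-congˡ (K.sym (coeff≈pairδ f m)) ⟩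
    factor c m * coeff f m ∎

  -- The component of Δ f in qₖ₊₁ ⊗ - is the derivative of f by qₖ₊₁.
  coeff-Δ : ∀ k m f → P.⊗².coeff (P.Δ f) ([ k ] , m) ≈ pair f (D k (δ m))
  coeff-Δ k m f = begin
    P.⊗².coeff (P.Δ f) ([ k ] , m)
      ≈⟨ coeff≈pair (×-decSetoid monomials monomials) (P.Δ f) ([ k ] , m) ⟩
    pair (P.Δ f) (λ (x , y) → 𝕀 (x ↭? [ k ] ×-dec y ↭? m))
      ≈⟨ pair-cong (P.Δ f) (λ (x , y) → 𝕀-× (x ↭? [ k ]) (y ↭? m)) ⟩
    pair (P.Δ f) (λ (x , y) → δ [ k ] x * δ m y)
      ≈⟨ pair-extend polynomialComult f _ ⟩
    pair f (λ μ → pair (polynomialComult μ) λ (x , y) → δ [ k ] x * δ m y)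
      ≈⟨ pair-cong f (λ μ → pair-comult-δ[-] k μ (δ m)) ⟩
    pair f (D k (δ m)) ∎

  δ[-]-++ : ∀ k μ ν → δ [ k ] (μ ++ ν) ≈ δ [] μ * δ [ k ] ν + δ [ k ] μ * δ [] ν
  δ[-]-++ k []      ν = K.sym (K.trans
    (+-cong (K.trans (*-congʳ (δ-refl [])) (*-identityˡ _))
            (K.trans (*-congʳ (δ[-]-[] k)) (zeroˡ _)))
    (+-identityʳ _))
  δ[-]-++ k (l ∷ μ) ν = begin
    δ [ k ] (l ∷ μ ++ ν)
      ≈⟨ δ[-]-∷ k l (μ ++ ν) ⟩
    𝕀 (l ℕ.≟ k) * δ [] (μ ++ ν)
      ≈⟨ *-congˡ (δ[]-++ μ) ⟩
    𝕀 (l ℕ.≟ k) * (δ [] μ * δ [] ν)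
      ≈⟨ K.trans (K.sym (*-assoc _ _ _)) (*-congʳ (K.sym (δ[-]-∷ k l μ))) ⟩
    δ [ k ] (l ∷ μ) * δ [] ν
      ≈⟨ K.sym (K.trans (+-congʳ (K.trans (*-congʳ (δ[]-∷ l μ)) (zeroˡ _))) (+-identityˡ _)) ⟩
    δ [] (l ∷ μ) * δ [ k ] ν + δ [ k ] (l ∷ μ) * δ [] ν ∎
    where
    δ[]-++ : ∀ μ → δ [] (μ ++ ν) ≈ δ [] μ * δ [] ν
    δ[]-++ []      = K.sym (K.trans (*-congʳ (δ-refl [])) (*-identityˡ _))
    δ[]-++ (l ∷ μ) = K.trans (δ[]-∷ l (μ ++ ν)) (K.sym (K.trans (*-congʳ (δ[]-∷ l μ)) (zeroˡ _)))

  -- The coefficient of a variable is a derivation over the counit.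
  coeff-·-var : ∀ k f g → coeff (f ·ᴾ g) [ k ] ≈
    coeff f [] * coeff g [ k ] + coeff f [ k ] * coeff g []
  coeff-·-var k f g = begin
    coeff (f ·ᴾ g) [ k ]
      ≈⟨ coeff≈pairδ (f ·ᴾ g) [ k ] ⟩
    pair (f ·ᴾ g) (δ [ k ])
      ≈⟨ pair-bilinear _++_ f g (δ [ k ]) ⟩
    pair f (λ μ → pair g λ ν → δ [ k ] (μ ++ ν))
      ≈⟨ pair-cong f (λ μ → K.trans (pair-cong g (δ[-]-++ k μ))
           (K.trans (pair-+ g (λ ν → δ [] μ * δ [ k ] ν) (λ ν → δ [ k ] μ * δ [] ν))
             (+-cong (pair-*ˡ g (δ [] μ) (δ [ k ])) (pair-*ˡ g (δ [ k ] μ) (δ []))))) ⟩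
    pair f (λ μ → δ [] μ * pair g (δ [ k ]) + δ [ k ] μ * pair g (δ []))
      ≈⟨ K.trans (pair-+ f _ _) (+-cong (pair-*ʳ f (δ []) _) (pair-*ʳ f (δ [ k ]) _)) ⟩
    pair f (δ []) * pair g (δ [ k ]) + pair f (δ [ k ]) * pair g (δ [])
      ≈⟨ K.sym (+-cong (*-cong (coeff≈pairδ f []) (coeff≈pairδ g [ k ]))
                       (*-cong (coeff≈pairδ f [ k ]) (coeff≈pairδ g []))) ⟩
    coeff f [] * coeff g [ k ] + coeff f [ k ] * coeff g [] ∎

  module _ (I : UmbralInvariant) where

    open GradedHopfHomomorphism I
    open LeftSemimoduleMorphisms.IsLeftSemimoduleHomomorphism linear using (⟦⟧-cong)
    open MonoidMorphisms.IsMonoidHomomorphism ·-homo using (homo; ε-homo)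

    -- The coefficient of m in I_G.
    coeffᴵ : Graph → Monomial → Carrier
    coeffᴵ (n , G) m = coeff (invariant I G) m

    invariant-cong : ∀ {G H : Graph} → G ≅ᴳ H → ∀ m → coeffᴵ G m ≈ coeffᴵ H m
    invariant-cong {G} {H} G≅H = ⟦⟧-cong λ F → +-congʳ (𝕀-cong (G G.≟ᴮ F) (H G.≟ᴮ F)
      (λ G≅F → ≅-trans {F = proj₂ H} {proj₂ G} {proj₂ F} (≅-sym {G = proj₂ G} {proj₂ H} G≅H) G≅F)
      (λ H≅F → ≅-trans {F = proj₂ G} {proj₂ H} {proj₂ F} G≅H H≅F))

    coeffᴵ-degree : ∀ G m → weight m ≢ order G → coeffᴵ G m ≈ 0#
    coeffᴵ-degree (n , G) m = invariant-homogeneous I G m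

    coeffᴵ-⊔ : ∀ k G H → coeffᴵ (G ⊔ᴳ H) [ k ] ≈
      coeffᴵ G [] * coeffᴵ H [ k ] + coeffᴵ G [ k ] * coeffᴵ H []
    coeffᴵ-⊔ k G H = begin
      coeffᴵ (G ⊔ᴳ H) [ k ]
        ≈⟨ ⟦⟧-cong (λ F → +-congʳ (1*1 (G ⊔ᴳ H G.≟ᴮ F))) [ k ] ⟩
      coeff ⟦ ⟨ G ⟩ G.· ⟨ H ⟩ ⟧ [ k ]
        ≈⟨ homo ⟨ G ⟩ ⟨ H ⟩ [ k ] ⟩
      coeff (⟦ ⟨ G ⟩ ⟧ ·ᴾ ⟦ ⟨ H ⟩ ⟧) [ k ]
        ≈⟨ coeff-·-var k ⟦ ⟨ G ⟩ ⟧ ⟦ ⟨ H ⟩ ⟧ ⟩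
      coeffᴵ G [] * coeffᴵ H [ k ] + coeffᴵ G [ k ] * coeffᴵ H [] ∎
      where
      1*1 : ∀ {P : Set} (d : Dec P) → 𝕀 d ≈ (if does d then 1# * 1# else 0#)
      1*1 (yes _) = K.sym (*-identityˡ 1#)
      1*1 (no _)  = K.refl

    constant≈0 : ∀ G {{_ : NonZero (order G)}} → coeffᴵ G [] ≈ 0#
    constant≈0 G = coeffᴵ-degree G [] (≢-sym (ℕ.≢-nonZero⁻¹ (order G)))

    disconnected⇒coeffᴵ≈0 : ∀ {n} (G : SimpleGraph (suc n)) → ¬ Connected G → ∀ k →
      coeffᴵ (suc n , G) [ k ] ≈ 0#
    disconnected⇒coeffᴵ≈0 G ¬conn k = let S , s≢0 , s′≢0 , G≅ = disconnected⇒⊔ G ¬conn in begin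
      coeffᴵ (_ , G) [ k ]
        ≈⟨ K.sym (invariant-cong G≅ [ k ]) ⟩
      coeffᴵ ((∣ S ∣ , G ↾ S) ⊔ᴳ (∣ ∁ S ∣ , G ↾ ∁ S)) [ k ]
        ≈⟨ coeffᴵ-⊔ k (∣ S ∣ , G ↾ S) (∣ ∁ S ∣ , G ↾ ∁ S) ⟩
      coeffᴵ (_ , G ↾ S) [] * coeffᴵ (_ , G ↾ ∁ S) [ k ] +
      coeffᴵ (_ , G ↾ S) [ k ] * coeffᴵ (_ , G ↾ ∁ S) []
        ≈⟨ +-cong
             (K.trans (*-congʳ (constant≈0 (_ , G ↾ S) {{s≢0}})) (zeroˡ _))
             (K.trans (*-congˡ (constant≈0 (_ , G ↾ ∁ S) {{s′≢0}})) (zeroʳ _)) ⟩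
      0# + 0#
        ≈⟨ +-identityˡ 0# ⟩
      0# ∎

    -- The comultiplicativity of I in the component qₖ₊₁ ⊗ m.
    pair-D-invariant : ∀ {n} (G : SimpleGraph n) k m →
      pair (invariant I G) (D k (δ m)) ≈
      ∑ (subsets n) λ S → coeffᴵ (∣ S ∣ , G ↾ S) [ k ] * coeffᴵ (∣ ∁ S ∣ , G ↾ ∁ S) m
    pair-D-invariant {n} G k m = begin
      pair (invariant I G) (D k (δ m))
        ≈⟨ K.sym (coeff-Δ k m (invariant I G)) ⟩
      P.⊗².coeff (P.Δ (invariant I G)) ([ k ] , m)
        ≈⟨ Δ-homo ⟨ (n , G) ⟩ ([ k ] , m) ⟩
      P.⊗².coeff (⟦_⟧⊗⟦_⟧ (G.Δ ⟨ (n , G) ⟩)) ([ k ] , m)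
        ≈⟨ coeff≈pair (×-decSetoid monomials monomials) (⟦_⟧⊗⟦_⟧ (G.Δ ⟨ (n , G) ⟩)) ([ k ] , m) ⟩
      pair (⟦_⟧⊗⟦_⟧ (G.Δ ⟨ (n , G) ⟩)) (λ (x , y) → 𝕀 (x ↭? [ k ] ×-dec y ↭? m))
        ≈⟨ pair-extend (λ (F , H) → ⟦ ⟨ F ⟩ ⟧ ⊗ ⟦ ⟨ H ⟩ ⟧) (G.Δ ⟨ (n , G) ⟩) _ ⟩
      pair (G.Δ ⟨ (n , G) ⟩) (λ (F , H) →
        pair (⟦ ⟨ F ⟩ ⟧ ⊗ ⟦ ⟨ H ⟩ ⟧) λ (x , y) → 𝕀 (x ↭? [ k ] ×-dec y ↭? m))
        ≈⟨ pair-cong (G.Δ ⟨ (n , G) ⟩) (λ (F , H) → tensor F H) ⟩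
      pair (G.Δ ⟨ (n , G) ⟩) (λ (F , H) → coeffᴵ F [ k ] * coeffᴵ H m)
        ≈⟨ K.trans (pair-extend G.comult ⟨ (n , G) ⟩ ψ)
             (pair-⟨⟩ {A = Graph} (n , G) λ F → pair (G.comult F) ψ) ⟩
      pair (G.comult (n , G)) (λ (F , H) → coeffᴵ F [ k ] * coeffᴵ H m)
        ≈⟨ ∑-concatMap (λ S → ⟨ induced G S ⟩ ⊗ ⟨ induced G (∁ S) ⟩) (subsets n) _ ⟩
      ∑ (subsets n) (λ S → pair (⟨ induced G S ⟩ ⊗ ⟨ induced G (∁ S) ⟩)
        λ (F , H) → coeffᴵ F [ k ] * coeffᴵ H m)
        ≈⟨ ∑-cong (subsets n) (λ S → K.trans
             (pair-⊗ ⟨ induced G S ⟩ ⟨ induced G (∁ S) ⟩ (λ F → coeffᴵ F [ k ]) (λ H → coeffᴵ H m))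
             (*-cong (K.trans (pair-⟨⟩ (induced G S) λ F → coeffᴵ F [ k ])
                        (invariant-cong {induced G S} {_ , G ↾ S} (induced≅↾ G S) [ k ]))
                     (K.trans (pair-⟨⟩ (induced G (∁ S)) λ H → coeffᴵ H m)
                        (invariant-cong {induced G (∁ S)} {_ , G ↾ ∁ S} (induced≅↾ G (∁ S)) m)))) ⟩
      ∑ (subsets n) (λ S → coeffᴵ (∣ S ∣ , G ↾ S) [ k ] * coeffᴵ (∣ ∁ S ∣ , G ↾ ∁ S) m) ∎
      where
      ψ : Graph × Graph → Carrier
      ψ (F , H) = coeffᴵ F [ k ] * coeffᴵ H m

      tensor : ∀ F H →
        pair (⟦ ⟨ F ⟩ ⟧ ⊗ ⟦ ⟨ H ⟩ ⟧) (λ (x , y) → 𝕀 (x ↭? [ k ] ×-dec y ↭? m)) ≈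
        coeffᴵ F [ k ] * coeffᴵ H m
      tensor F H = begin
        pair (⟦ ⟨ F ⟩ ⟧ ⊗ ⟦ ⟨ H ⟩ ⟧) (λ (x , y) → 𝕀 (x ↭? [ k ] ×-dec y ↭? m))
          ≈⟨ pair-cong (⟦ ⟨ F ⟩ ⟧ ⊗ ⟦ ⟨ H ⟩ ⟧) (λ (x , y) → 𝕀-× (x ↭? [ k ]) (y ↭? m)) ⟩
        pair (⟦ ⟨ F ⟩ ⟧ ⊗ ⟦ ⟨ H ⟩ ⟧) (λ (x , y) → δ [ k ] x * δ m y)
          ≈⟨ pair-⊗ ⟦ ⟨ F ⟩ ⟧ ⟦ ⟨ H ⟩ ⟧ (δ [ k ]) (δ m) ⟩
        pair ⟦ ⟨ F ⟩ ⟧ (δ [ k ]) * pair ⟦ ⟨ H ⟩ ⟧ (δ m)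
          ≈⟨ K.sym (*-cong (coeff≈pairδ ⟦ ⟨ F ⟩ ⟧ [ k ]) (coeff≈pairδ ⟦ ⟨ H ⟩ ⟧ m)) ⟩
        coeffᴵ F [ k ] * coeffᴵ H m ∎

    -- The coefficient of m in the sum of I over all labelled graphs of order n.
    total : ℕ → Monomial → Carrier
    total n m = ∑ (labelledGraphs n) λ G → coeffᴵ (n , G) m

    total-degree : ∀ n m → weight m ≢ n → total n m ≈ 0#
    total-degree n m w≢n = ∑-0 (labelledGraphs n) λ G → coeffᴵ-degree (n , G) m w≢n

    -- Only subsets S of size k + 1 contribute, since I is graded.
    ∑-pair-D-invariant : ∀ k n m →
      ∑ (labelledGraphs (suc k ℕ.+ n)) (λ G → pair (invariant I G) (D k (δ m))) ≈
      ⌜ (suc k ℕ.+ n) C suc k ⌝ * (⌜ 2 ^ (suc k ℕ.* n) ⌝ * (total (suc k) [ k ] * total n m))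
    ∑-pair-D-invariant k n m = begin
      ∑ (labelledGraphs N) (λ G → pair (invariant I G) (D k (δ m)))
        ≈⟨ ∑-cong (labelledGraphs N) (λ G → pair-D-invariant G k m) ⟩
      ∑ (labelledGraphs N) (λ G → ∑ (subsets N) λ S →
        coeffᴵ (∣ S ∣ , G ↾ S) [ k ] * coeffᴵ (∣ ∁ S ∣ , G ↾ ∁ S) m)
        ≈⟨ ∑-swap (labelledGraphs N) (subsets N) _ ⟩
      ∑ (subsets N) (λ S → ∑ (labelledGraphs N) λ G →
        coeffᴵ (∣ S ∣ , G ↾ S) [ k ] * coeffᴵ (∣ ∁ S ∣ , G ↾ ∁ S) m)
        ≈⟨ ∑-cong (subsets N) factorise ⟩
      ∑ (subsets N) (λ S → h ∣ S ∣)
        ≈⟨ ∑-size N (suc k) h (λ j j≢ → K.trans (*-congˡ (K.trans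
             (*-congʳ (total-degree j [ k ] λ e → j≢ (≡.trans (≡.sym e) (ℕ.+-identityʳ _))))
             (zeroˡ _))) (zeroʳ _)) ⟩
      ⌜ N C suc k ⌝ * h (suc k)
        ≡⟨ ≡.cong (λ n → ⌜ N C suc k ⌝ * (⌜ 2 ^ (suc k ℕ.* n) ⌝ * (total (suc k) [ k ] * total n m)))
                  (ℕ.m+n∸m≡n k n) ⟩
      ⌜ N C suc k ⌝ * (⌜ 2 ^ (suc k ℕ.* n) ⌝ * (total (suc k) [ k ] * total n m)) ∎
      where
      N : ℕ
      N = suc k ℕ.+ n
      -- The contribution of a subset of size j.
      h : ℕ → Carrier
      h j = ⌜ 2 ^ (j ℕ.* (N ∸ j)) ⌝ * (total j [ k ] * total (N ∸ j) m)

      factorise : ∀ S → ∑ (labelledGraphs N) (λ G →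
        coeffᴵ (∣ S ∣ , G ↾ S) [ k ] * coeffᴵ (∣ ∁ S ∣ , G ↾ ∁ S) m) ≈ h ∣ S ∣
      factorise S = begin
        ∑ (labelledGraphs N) (λ G → coeffᴵ (∣ S ∣ , G ↾ S) [ k ] * coeffᴵ (∣ ∁ S ∣ , G ↾ ∁ S) m)
          ≈⟨ ∑-induced S (λ F H → coeffᴵ (∣ S ∣ , F) [ k ] * coeffᴵ (∣ ∁ S ∣ , H) m)
               (λ {F} {F′} {H} {H′} e e′ → *-cong
                 (invariant-cong {_ , F} {_ , F′} (≗ᴳ⇒≅ {G = F} {F′} e) [ k ])
                 (invariant-cong {_ , H} {_ , H′} (≗ᴳ⇒≅ {G = H} {H′} e′) m)) ⟩
        ⌜ 2 ^ (∣ S ∣ ℕ.* ∣ ∁ S ∣) ⌝ * ∑ (labelledGraphs ∣ S ∣) (λ F → ∑ (labelledGraphs ∣ ∁ S ∣) λ H →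
          coeffᴵ (∣ S ∣ , F) [ k ] * coeffᴵ (∣ ∁ S ∣ , H) m)
          ≈⟨ *-congˡ (K.trans (∑-cong (labelledGraphs ∣ S ∣) λ F → ∑-*ˡ (labelledGraphs ∣ ∁ S ∣) _ _)
                              (∑-*ʳ (labelledGraphs ∣ S ∣) _ _)) ⟩
        ⌜ 2 ^ (∣ S ∣ ℕ.* ∣ ∁ S ∣) ⌝ * ((total ∣ S ∣) [ k ] * (total ∣ ∁ S ∣) m)
          ≡⟨ ≡.cong (λ j → ⌜ 2 ^ (∣ S ∣ ℕ.* j) ⌝ * ((total ∣ S ∣) [ k ] * total j m)) (∣∁p∣≡n∸∣p∣ S) ⟩
        h ∣ S ∣ ∎

    copies : ∀ {n} (r : SimpleGraph n) →
      ∑ (labelledGraphs n) (λ G → 𝕀 (r ≅? G)) ≈ ⌜ n ! ⌝ * 1/∣Aut r ∣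
    copies {n} r = ⌜⌝-cancel ∣Aut r ∣ {{∣Aut∣-nonZero r}} (begin
      ⌜ ∣Aut r ∣ ⌝ * ∑ (labelledGraphs n) (λ G → 𝕀 (r ≅? G))
        ≈⟨ ∣Aut∣*copies r ⟩
      ⌜ n ! ⌝
        ≈⟨ K.sym (*-identityʳ _) ⟩
      ⌜ n ! ⌝ * 1#
        ≈⟨ *-congˡ (K.sym (1/-inverse ∣Aut r ∣ {{∣Aut∣-nonZero r}})) ⟩
      ⌜ n ! ⌝ * (⌜ ∣Aut r ∣ ⌝ * 1/∣Aut r ∣)
        ≈⟨ solve 3 (λ x y z → x :* (y :* z) := y :* (x :* z)) K.refl _ _ _ ⟩
      ⌜ ∣Aut r ∣ ⌝ * (⌜ n ! ⌝ * 1/∣Aut r ∣) ∎)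

    total≈∑isoClasses : ∀ n m → total n m ≈
      ⌜ n ! ⌝ * ∑ (isoClasses n) λ r → 1/∣Aut r ∣ * coeffᴵ (n , r) m
    total≈∑isoClasses n m = begin
      total n m
        ≈⟨ ∑-labelledGraphs n (λ G → coeffᴵ (n , G) m)
             (λ {G} {H} e → invariant-cong {n , G} {n , H} e m) ⟩
      ∑ (isoClasses n) (λ r → ∑ (labelledGraphs n) (λ G → 𝕀 (r ≅? G)) * coeffᴵ (n , r) m)
        ≈⟨ ∑-cong (isoClasses n) (λ r → K.trans (*-congʳ (copies r)) (*-assoc _ _ _)) ⟩
      ∑ (isoClasses n) (λ r → ⌜ n ! ⌝ * (1/∣Aut r ∣ * coeffᴵ (n , r) m))
        ≈⟨ ∑-*ˡ (isoClasses n) _ _ ⟩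
      ⌜ n ! ⌝ * ∑ (isoClasses n) (λ r → 1/∣Aut r ∣ * coeffᴵ (n , r) m) ∎

    coeff-ℐ° : ∀ n m → coeff (ℐ° I n) m ≈ ∑ (isoClasses n) λ r → 1/∣Aut r ∣ * coeffᴵ (n , r) m
    coeff-ℐ° n m = K.trans (coeff-∑P (isoClasses n) _ m) (∑-cong (isoClasses n) λ r →
      K.trans (coeff-• 1/∣Aut r ∣ (part n (invariant I r)) m) (*-congˡ (whole r (weight m ℕ.≟ n))))
      where
      whole : ∀ r → Dec (weight m ≡ n) → coeff (part n (invariant I r)) m ≈ coeffᴵ (n , r) m
      whole r (yes w≡n) = P.part-≡ n (invariant I r) m w≡n
      whole r (no  w≢n) = K.trans (P.part-≢ n (invariant I r) m w≢n) (K.sym (coeffᴵ-degree (n , r) m w≢n))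

    total≈n!*ℐ° : ∀ n m → total n m ≈ ⌜ n ! ⌝ * coeff (ℐ° I n) m
    total≈n!*ℐ° n m = K.trans (total≈∑isoClasses n m) (*-congˡ (K.sym (coeff-ℐ° n m)))

    -- Disconnected graphs contribute nothing to the left-hand side.
    total≈i : ∀ k → total (suc k) [ k ] ≈ i I (suc k)
    total≈i k = K.trans (total≈∑isoClasses (suc k) [ k ]) (*-congˡ (begin
      ∑ (isoClasses (suc k)) (λ r → 1/∣Aut r ∣ * coeffᴵ (suc k , r) [ k ])
        ≈⟨ ∑-cong (isoClasses (suc k)) (λ r → K.trans (*-comm _ _) (connected r (connected? r))) ⟩
      ∑ (isoClasses (suc k)) (λ r → 𝕀 (connected? r) * (coeffᴵ (suc k , r) [ k ] * 1/∣Aut r ∣))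
        ≈⟨ K.sym (∑-filter connected? (isoClasses (suc k)) _) ⟩
      ∑ (connectedClasses (suc k)) (λ r → coeffᴵ (suc k , r) [ k ] * 1/∣Aut r ∣) ∎))
      where
      connected : ∀ r (d : Dec (Connected r)) →
        coeffᴵ (suc k , r) [ k ] * 1/∣Aut r ∣ ≈ 𝕀 d * (coeffᴵ (suc k , r) [ k ] * 1/∣Aut r ∣)
      connected r (yes _)    = K.sym (*-identityˡ _)
      connected r (no ¬conn) = K.trans
        (K.trans (*-congʳ (disconnected⇒coeffᴵ≈0 r ¬conn k)) (zeroˡ _)) (K.sym (zeroˡ _))

    ℐ°-degree : ∀ n m → weight m ≢ n → coeff (ℐ° I n) m ≈ 0#
    ℐ°-degree n m w≢n = K.trans (coeff-ℐ° n m) (∑-0 (isoClasses n) λ r →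
      K.trans (*-congˡ (coeffᴵ-degree (n , r) m w≢n)) (zeroʳ _))

    ℐ°-0 : coeff (ℐ° I 0) [] ≈ 1#
    ℐ°-0 = begin
      coeff (ℐ° I 0) []
        ≈⟨ K.sym (K.trans (*-congʳ fromNat-1) (*-identityˡ _)) ⟩
      ⌜ 1 ⌝ * coeff (ℐ° I 0) []
        ≈⟨ K.sym (total≈n!*ℐ° 0 []) ⟩
      coeffᴵ (0 , emptyGraph) [] + 0#
        ≈⟨ +-identityʳ _ ⟩
      coeffᴵ (0 , emptyGraph) []
        ≈⟨ ε-homo [] ⟩
      coeff 1ᴾ []
        ≈⟨ K.trans (coeff≈pairδ 1ᴾ []) (K.trans (pair-⟨⟩ [] (δ [])) (δ-refl [])) ⟩
      1# ∎

    module _ (i#0 : ∀ n .{{_ : NonZero n}} → i I n # 0#) where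

      scale : Monomial → Carrier
      scale = factor (scaling I i#0)

      ℐ°-recurrence : ∀ k n m →
        ⌜ suc k ! ⌝ * (⌜ suc (multiplicity k m) ⌝ * coeff (ℐ° I (suc k ℕ.+ n)) (k ∷ m)) ≈
        ⌜ 2 ^ (suc k ℕ.* n) ⌝ * (i I (suc k) * coeff (ℐ° I n) m)
      ℐ°-recurrence k n m = ⌜⌝-cancel (N !) {{ℕ._!≢0 N}} (begin
        ⌜ N ! ⌝ * (⌜ suc k ! ⌝ * (⌜ suc t ⌝ * coeff (ℐ° I N) (k ∷ m)))
          ≈⟨ solve 4 (λ a b c d → a :* (b :* (c :* d)) := b :* (c :* (a :* d))) K.refl _ _ _ _ ⟩
        ⌜ suc k ! ⌝ * (⌜ suc t ⌝ * (⌜ N ! ⌝ * coeff (ℐ° I N) (k ∷ m)))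
          ≈⟨ *-congˡ (*-congˡ (K.sym (total≈n!*ℐ° N (k ∷ m)))) ⟩
        ⌜ suc k ! ⌝ * (⌜ suc t ⌝ * total N (k ∷ m))
          ≈⟨ *-congˡ (K.sym (∑-*ˡ (labelledGraphs N) _ _)) ⟩
        ⌜ suc k ! ⌝ * ∑ (labelledGraphs N) (λ G → ⌜ suc t ⌝ * coeffᴵ (N , G) (k ∷ m))
          ≈⟨ *-congˡ (∑-cong (labelledGraphs N) λ G → K.sym (pair-Dδ k m (invariant I G))) ⟩
        ⌜ suc k ! ⌝ * ∑ (labelledGraphs N) (λ G → pair (invariant I G) (D k (δ m)))
          ≈⟨ *-congˡ (∑-pair-D-invariant k n m) ⟩
        ⌜ suc k ! ⌝ * (⌜ N C suc k ⌝ * (⌜ 2 ^ (suc k ℕ.* n) ⌝ * (total (suc k) [ k ] * total n m)))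
          ≈⟨ *-congˡ (*-congˡ (*-congˡ (*-cong (total≈i k) (total≈n!*ℐ° n m)))) ⟩
        ⌜ suc k ! ⌝ * (⌜ N C suc k ⌝ * (⌜ 2 ^ (suc k ℕ.* n) ⌝ * (i I (suc k) * (⌜ n ! ⌝ * coeff (ℐ° I n) m))))
          ≈⟨ solve 6 (λ a b c d e f → a :* (b :* (c :* (d :* (e :* f)))) :=
               (b :* (a :* e)) :* (c :* (d :* f)))
               K.refl _ _ _ _ _ _ ⟩
        (⌜ N C suc k ⌝ * (⌜ suc k ! ⌝ * ⌜ n ! ⌝)) * (⌜ 2 ^ (suc k ℕ.* n) ⌝ * (i I (suc k) * coeff (ℐ° I n) m))
          ≈⟨ *-congʳ (K.trans (*-congˡ (K.sym (fromNat-* (suc k !) (n !))))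
               (K.trans (K.sym (fromNat-* (N C suc k) (suc k ! ℕ.* n !)))
                 (reflexive (≡.cong ⌜_⌝ (C*k!*n! (suc k) n))))) ⟩
        ⌜ N ! ⌝ * (⌜ 2 ^ (suc k ℕ.* n) ⌝ * (i I (suc k) * coeff (ℐ° I n) m)) ∎)
        where
        N t : ℕ
        N = suc k ℕ.+ n
        t = multiplicity k m

      -- Multiplied by the positive integers (k + 1)! and 1 + t, both sides become
      -- k! 2^(N(N-1)/2) times the coefficient of m in sₙ, where N = k + 1 + n.
      scale-step : ∀ k n m →
        scale m * coeff (ℐ° I n) m ≈ ⌜ 2 ^ pairs n ⌝ * coeff (schur n) m →
        scale (k ∷ m) * coeff (ℐ° I (suc k ℕ.+ n)) (k ∷ m) ≈
        ⌜ 2 ^ pairs (suc k ℕ.+ n) ⌝ * coeff (schur (suc k ℕ.+ n)) (k ∷ m)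
      scale-step k n m ih = ⌜⌝-cancel (suc t)
        (⌜⌝-cancel (suc k !) {{ℕ._!≢0 (suc k)}} (K.trans lhs (K.sym rhs)))
        where
        N t : ℕ
        N = suc k ℕ.+ n
        t = multiplicity k m
        p q e i′ r F F′ S S′ : Carrier
        p  = ⌜ 2 ^ pairs (suc k) ⌝
        q  = ⌜ 2 ^ pairs n ⌝
        e  = ⌜ 2 ^ (suc k ℕ.* n) ⌝
        i′ = recip (i#0 (suc k))
        r  = 1/ (suc k)
        F  = coeff (ℐ° I N) (k ∷ m)
        F′ = coeff (ℐ° I n) m
        S  = coeff (schur N) (k ∷ m)
        S′ = coeff (schur n) m

        lhs : ⌜ suc k ! ⌝ * (⌜ suc t ⌝ * (scale (k ∷ m) * F)) ≈ ⌜ k ! ⌝ * (⌜ 2 ^ pairs N ⌝ * S′)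
        lhs = begin
          ⌜ suc k ! ⌝ * (⌜ suc t ⌝ * (((⌜ 2 ^ pairs (suc k) ℕ.* k ! ⌝ * i′) * scale m) * F))
            ≈⟨ solve 6 (λ a b c d f g → a :* (b :* (((c :* d) :* f) :* g)) :=
                 (c :* d :* f) :* (a :* (b :* g)))
                 K.refl _ _ _ _ _ _ ⟩
          (⌜ 2 ^ pairs (suc k) ℕ.* k ! ⌝ * i′ * scale m) * (⌜ suc k ! ⌝ * (⌜ suc t ⌝ * F))
            ≈⟨ *-cong (*-congʳ (*-congʳ (fromNat-* (2 ^ pairs (suc k)) (k !))))
                      (ℐ°-recurrence k n m) ⟩
          (p * ⌜ k ! ⌝ * i′ * scale m) * (e * (i I (suc k) * F′))
            ≈⟨ solve 7 (λ p f i′ s e i F → (p :* f :* i′ :* s) :* (e :* (i :* F)) :=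
                 (i :* i′) :* (f :* ((p :* e) :* (s :* F))))
                 K.refl _ _ _ _ _ _ _ ⟩
          (i I (suc k) * i′) * (⌜ k ! ⌝ * ((p * e) * (scale m * F′)))
            ≈⟨ *-cong (recip-inverse (i#0 (suc k))) (*-congˡ (*-congˡ ih)) ⟩
          1# * (⌜ k ! ⌝ * ((p * e) * (q * S′)))
            ≈⟨ K.trans (*-identityˡ _) (*-congˡ (K.sym (*-assoc _ _ _))) ⟩
          ⌜ k ! ⌝ * (p * e * q * S′)
            ≈⟨ *-congˡ (*-congʳ (2^pairs-+ (suc k) n)) ⟩
          ⌜ k ! ⌝ * (⌜ 2 ^ pairs N ⌝ * S′) ∎

        rhs : ⌜ suc k ! ⌝ * (⌜ suc t ⌝ * (⌜ 2 ^ pairs N ⌝ * S)) ≈ ⌜ k ! ⌝ * (⌜ 2 ^ pairs N ⌝ * S′)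
        rhs = begin
          ⌜ suc k ! ⌝ * (⌜ suc t ⌝ * (⌜ 2 ^ pairs N ⌝ * S))
            ≈⟨ *-cong (fromNat-* (suc k) (k !))
                 (solve 3 (λ a b c → a :* (b :* c) := b :* (a :* c)) K.refl _ _ _) ⟩
          (⌜ suc k ⌝ * ⌜ k ! ⌝) * (⌜ 2 ^ pairs N ⌝ * (⌜ suc t ⌝ * S))
            ≈⟨ *-congˡ (*-congˡ (K.trans (K.sym (pair-Dδ k m (schur N)))
                 (K.trans (schur-D k (δ m) n) (*-congˡ (K.sym (coeff≈pairδ (schur n) m)))))) ⟩
          (⌜ suc k ⌝ * ⌜ k ! ⌝) * (⌜ 2 ^ pairs N ⌝ * (r * S′))
            ≈⟨ solve 5 (λ a b c d f → (a :* b) :* (c :* (d :* f)) :=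
                 (a :* d) :* (b :* (c :* f))) K.refl _ _ _ _ _ ⟩
          (⌜ suc k ⌝ * r) * (⌜ k ! ⌝ * (⌜ 2 ^ pairs N ⌝ * S′))
            ≈⟨ K.trans (*-congʳ (1/-inverse (suc k))) (*-identityˡ _) ⟩
          ⌜ k ! ⌝ * (⌜ 2 ^ pairs N ⌝ * S′) ∎

      scale-ℐ° : ∀ m n → scale m * coeff (ℐ° I n) m ≈ ⌜ 2 ^ pairs n ⌝ * coeff (schur n) m
      scale-ℐ° [] zero = K.trans (*-identityˡ _) (K.trans ℐ°-0 (K.sym (K.trans
        (*-cong fromNat-1 (K.trans (coeff≈pairδ (schur 0) []) schur-0-δ[])) (*-identityˡ _))))
      scale-ℐ° [] (suc n) = K.trans
        (K.trans (*-congˡ (ℐ°-degree (suc n) [] λ ())) (zeroʳ _))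
        (K.sym (K.trans (*-congˡ (K.trans (coeff≈pairδ (schur (suc n)) []) (schur-suc-δ[] n))) (zeroʳ _)))
      scale-ℐ° (k ∷ m) n with n ℕ.≤? k
      ... | yes n≤k = K.trans
        (K.trans (*-congˡ (ℐ°-degree n (k ∷ m) λ w≡n →
          ℕ.<⇒≱ (s≤s (ℕ.m≤m+n k (weight m))) (ℕ.≤-trans (ℕ.≤-reflexive w≡n) n≤k))) (zeroʳ _))
        (K.sym (K.trans (*-congˡ schur≈0) (zeroʳ _)))
        where
        schur≈0 : coeff (schur n) (k ∷ m) ≈ 0#
        schur≈0 = ⌜⌝-cancel (suc (multiplicity k m)) (K.trans
          (K.sym (pair-Dδ k m (schur n))) (K.trans (schur-D-0 k (δ m) n≤k) (K.sym (zeroʳ _))))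
      ... | no n≰k = ≡.subst
        (λ n → scale (k ∷ m) * coeff (ℐ° I n) (k ∷ m) ≈ ⌜ 2 ^ pairs n ⌝ * coeff (schur n) (k ∷ m))
        (ℕ.m+[n∸m]≡n (ℕ.≰⇒> n≰k))
        (scale-step k (n ∸ suc k) m (scale-ℐ° m (n ∸ suc k)))

      rescaled-ℐ°≋𝒮 : (λ n → rescale (scaling I i#0) (ℐ° I n)) ≋ˢ 𝒮
      rescaled-ℐ°≋𝒮 n m = begin
        coeff (rescale (scaling I i#0) (ℐ° I n)) m
          ≈⟨ coeff-rescale (scaling I i#0) (ℐ° I n) m ⟩
        scale m * coeff (ℐ° I n) m
          ≈⟨ scale-ℐ° m n ⟩
        ⌜ 2 ^ pairs n ⌝ * coeff (schur n) m
          ≈⟨ K.sym (coeff-• ⌜ 2 ^ pairs n ⌝ (schur n) m) ⟩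
        coeff (𝒮 n) m ∎

theorem2p4 : ∀ {c ℓ₁ ℓ₂} (K : HeytingField c ℓ₁ ℓ₂) (char0 : CharacteristicZero K) →
    let open HeytingField K
        open Invariants K char0 in
    (I : UmbralInvariant) (i#0 : ∀ n .{{_ : NonZero n}} → i I n # 0#) →
    (λ n → rescale (scaling I i#0) (ℐ° I n)) ≋ˢ 𝒮
theorem2p4 K char0 = GeneratingFunction.rescaled-ℐ°≋𝒮 K char0
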